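{- Let $|q|<1$. Let $G'(n)$ be the number of partitions of $n$ into parts of two colors (red and blue) in which the smallest part is odd, say equal to $2m+1$, and every red part is even and lies in the interval $(2m,4m]$; equivalently \[ \sum_{n=0}^\infty G'(n)q^n=\sum_{m=0}^\infty\frac{q^{2m+1}}{(q^{2m+1};q)_\infty(q^{2m+2};q^2)_m}. \] Let $\phi_3(q)=\sum_{n=0}^\infty\frac{q^{n^2}}{(-q^2;q^2)_n}$ be Ramanujan's third order mock theta function. Then \[ \sum_{n=0}^\infty G'(n)q^n=q^2-q(1+q)\phi_3(-q)+\frac{q(3-q)}{2(q;q)_\infty}+\frac{q(1+q)(q^2;q^2)_\infty}{2(-q;q)_\infty^3}. \]
   Context: For $N\ge1$, $(A;q)_N=(1-A)(1-Aq)\cdots(1-Aq^{N-1})$, $(A;q)_0=1$, and $(A;q)_\infty=\lim_{N\to\infty}(A;q)_N$. In the two-color partitions, parts of different colors are distinguished and the order of parts is irrelevant. -}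

module Defs where

-- Formal power series in q with integer coefficients, as coefficient functions.
-- An identity of analytic functions on |q| < 1 given by convergent power series
-- is equivalent to the equality of all their Taylor coefficients.

open import Data.Nat as ℕ using (ℕ; zero; suc; _∸_; _≡ᵇ_)
open import Data.Integer as ℤ using (ℤ; +_; -_)
open import Data.Bool using (if_then_else_)

Series : Set
Series = ℕ → ℤ

sumTo : ℕ → (ℕ → ℤ) → ℤ
sumTo zero h = h zero
sumTo (suc n) h = sumTo n h ℤ.+ h (suc n)

const : ℤ → Series
const c zero = c
const c (suc _) = + 0

qpow : ℕ → Series
qpow k n = if n ≡ᵇ k then + 1 else + 0

infixl 6 _+ₛ_ _-ₛ_
infixl 7 _*ₛ_ _·ₛ_

_+ₛ_ : Series → Series → Series
(f +ₛ g) n = f n ℤ.+ g n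

_-ₛ_ : Series → Series → Series
(f -ₛ g) n = f n ℤ.- g n

_·ₛ_ : ℤ → Series → Series
(c ·ₛ f) n = c ℤ.* f n

_*ₛ_ : Series → Series → Series
(f *ₛ g) n = sumTo n (λ i → f i ℤ.* g (n ∸ i))

negq : Series → Series
negq f n = sgn n ℤ.* f n
  where
  sgn : ℕ → ℤ
  sgn zero = + 1
  sgn (suc k) = - sgn k

-- Multiplicative inverse of a series with constant term 1:
-- g 0 = 1,  g (n+1) = - Σ_{i=0}^{n} f (i+1) g (n - i).
-- (The first argument is fuel; fuel n suffices for coefficient n.)
invAux : Series → ℕ → ℕ → ℤ
invAux f _ zero = + 1
invAux f zero (suc n) = + 0
invAux f (suc fuel) (suc n) = - sumTo n (λ i → f (suc i) ℤ.* invAux f fuel (n ∸ i))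

inv : Series → Series
inv f n = invAux f n n

finProd : (ℕ → Series) → ℕ → Series
finProd F zero = const (+ 1)
finProd F (suc N) = finProd F N *ₛ F N

-- infinite product Π_{j ≥ 0} F j, for factors with F j ≡ 1 mod q^(j+1):
-- coefficient n only depends on the factors F 0 … F n.
infProd : (ℕ → Series) → Series
infProd F n = finProd F (suc n) n

-- infinite sum Σ_{m ≥ 0} F m, for terms with F m = O(q^(m+1)):
-- coefficient n only depends on the terms F 0 … F n.
infSum : (ℕ → Series) → Series
infSum F n = sumTo n (λ m → F m n)

poch : ℤ → ℕ → ℕ → ℕ → Series
poch c a s N = finProd (λ j → const (+ 1) -ₛ c ·ₛ qpow (a ℕ.+ j ℕ.* s)) N

pochInf : ℤ → ℕ → ℕ → Series
pochInf c a s = infProd (λ j → const (+ 1) -ₛ c ·ₛ qpow (a ℕ.+ j ℕ.* s))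

G'gen : Series
G'gen = infSum (λ m → qpow (2 ℕ.* m ℕ.+ 1)
                   *ₛ inv (pochInf (+ 1) (2 ℕ.* m ℕ.+ 1) 1 *ₛ poch (+ 1) (2 ℕ.* m ℕ.+ 2) 2 m))

G' : ℕ → ℤ
G' n = G'gen n

phi3 : Series
phi3 = infSum (λ n → qpow (n ℕ.* n) *ₛ inv (poch (- + 1) 2 2 n))

twiceRHS : Series
twiceRHS =
    (+ 2) ·ₛ qpow 2
  -ₛ (+ 2) ·ₛ (qpow 1 +ₛ qpow 2) *ₛ negq phi3
  +ₛ ((+ 3) ·ₛ qpow 1 -ₛ qpow 2) *ₛ inv (pochInf (+ 1) 1 1)
  +ₛ (qpow 1 +ₛ qpow 2) *ₛ pochInf (+ 1) 2 2
       *ₛ inv (pochInf (- + 1) 1 1 *ₛ pochInf (- + 1) 1 1 *ₛ pochInf (- + 1) 1 1)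

-- Let T = ∑ q^(2n) (q²;q²)ₙ / (−q;q)₂ₙ, so that the left-hand side is q T / (q;q)∞,
-- and let P = ∑ q^(2n) / (−q;q)₂ₙ.  The q-difference equation in z satisfied by
-- ∑ q^(2m) / ((−q;q)₂ₘ (z q^(2m);q²)∞), iterated from z = q² down to z = 0, relates T
-- to (q;q)∞ P up to two series A and B, which further telescopings eliminate.
-- Likewise the sums ∑ q^(2m) / ((−q;q²)ₘ (−q²;q²)ₘ₊ₙ) satisfy a recurrence in n whose
-- iteration from P (n = 0) produces φ₃(−q) and the theta series ∑ (−1)ⁿ q^(n²), which
-- Gauss's identity evaluates as (q;q)∞ / (−q;q)∞.

module Submission where

open import Defs
open import Algebra.Bundles using (CommutativeRing)
import Algebra.Solver.Ring as RingSolver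
open import Algebra.Solver.Ring.AlmostCommutativeRing
  using (fromCommutativeRing; _-Raw-AlmostCommutative⟶_)
open import Data.Integer.Base using (∣_∣)
open import Data.Integer.Properties as ℤ using ()
open import Data.Integer.Tactic.RingSolver using (solve-∀)
open import Data.Maybe.Base using (Maybe; just; nothing)
open import Data.Nat as ℕ using (ℕ; zero; suc; _∸_; z≤n; s≤s)
open import Data.Nat.Properties as ℕ using ()
open import Data.Integer using (ℤ; +_; _*_)
import Data.Integer as ℤ
open import Data.Product using (_,_)
import Data.Sign.Base as Sign
open import Data.Sum.Base using (inj₁; inj₂)
open import Function.Base using (_∘_)
open import Level using (0ℓ)
open import Relation.Binary.PropositionalEquality as ≡ using (_≡_; _≗_)
open import Relation.Nullary.Decidable using (yes; no)

-- The iteration in z alone does not evaluate T: its inhomogeneous terms leave the series A = ∑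
-- q^(2n+2) (q²;q²)ₙ / (-q;q)₂ₙ₊₃, which is of the same kind as T. A direct telescoping supplies a
-- second relation in which A has the same coefficient while T stands on the other side. Subtracting
-- removes A and produces 2T, the origin of the halves in the theorem; clearing them keeps
-- everything over the integers. B is absorbed into P because ∑ q^N / (-q;q)_N telescopes. Each of
-- these relations rests on an explicit antidifference `K`. Once all reciprocal products are raised
-- to a common index, its verification is a polynomial identity in q, powers such as q^(2n) and the
-- remaining products, which the ring solver decides. Analysis enters only as q-adic convergence of
-- `K` to its boundary value.

infix  4 _≈_
infixl 6 _⊕_
infixl 7 _⊗_
infix  8 ⊖_

-- Without eta, and with operations defined by copatterns, the operations on
-- power series do not unfold during unification.
record PowerSeries : Set where
  no-eta-equality
  field coeff : Series
open PowerSeries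

record _≈_ (f g : PowerSeries) : Set where
  constructor mk
  field at : ∀ n → coeff f n ≡ coeff g n
open _≈_

⟪_⟫ : Series → PowerSeries
coeff ⟪ f ⟫ = f

constant : ℤ → PowerSeries
coeff (constant c) = const c

𝟎 𝟏 : PowerSeries
𝟎 = constant (+ 0)
𝟏 = constant (+ 1)

_⊕_ _⊗_ : PowerSeries → PowerSeries → PowerSeries
coeff (f ⊕ g) = coeff f +ₛ coeff g
coeff (f ⊗ g) = coeff f *ₛ coeff g

⊖_ : PowerSeries → PowerSeries
coeff (⊖ f) n = ℤ.- coeff f n

-- The Cauchy product and the commutative ring of formal power series

tail : Series → Series
tail f n = f (suc n)

sumTo-cong : ∀ n {g h : ℕ → ℤ} → (∀ i → i ℕ.≤ n → g i ≡ h i) → sumTo n g ≡ sumTo n h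
sumTo-cong zero    p = p 0 z≤n
sumTo-cong (suc n) p =
  ≡.cong₂ ℤ._+_ (sumTo-cong n λ i i≤n → p i (ℕ.m≤n⇒m≤1+n i≤n)) (p (suc n) ℕ.≤-refl)

sumTo-head : ∀ n h → sumTo (suc n) h ≡ h 0 ℤ.+ sumTo n (h ∘ suc)
sumTo-head zero    h = ≡.refl
sumTo-head (suc n) h =
  ≡.trans (≡.cong (ℤ._+ h (suc (suc n))) (sumTo-head n h)) (ℤ.+-assoc (h 0) _ _)

sumTo-zero : ∀ n {h} → (∀ i → i ℕ.≤ n → h i ≡ + 0) → sumTo n h ≡ + 0
sumTo-zero zero    p = p 0 z≤n
sumTo-zero (suc n) p =
  ≡.cong₂ ℤ._+_ (sumTo-zero n λ i i≤n → p i (ℕ.m≤n⇒m≤1+n i≤n)) (p (suc n) ℕ.≤-refl)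

sumTo-+ : ∀ n g h → sumTo n (λ i → g i ℤ.+ h i) ≡ sumTo n g ℤ.+ sumTo n h
sumTo-+ zero    g h = ≡.refl
sumTo-+ (suc n) g h = ≡.trans (≡.cong (ℤ._+ (g (suc n) ℤ.+ h (suc n))) (sumTo-+ n g h))
  (interchange (sumTo n g) (sumTo n h) (g (suc n)) (h (suc n)))
  where
  interchange : ∀ a b c d → (a ℤ.+ b) ℤ.+ (c ℤ.+ d) ≡ (a ℤ.+ c) ℤ.+ (b ℤ.+ d)
  interchange = solve-∀

sumTo-* : ∀ n c h → sumTo n (λ i → c * h i) ≡ c * sumTo n h
sumTo-* zero    c h = ≡.refl
sumTo-* (suc n) c h = ≡.trans (≡.cong (ℤ._+ c * h (suc n)) (sumTo-* n c h))
  (≡.sym (ℤ.*-distribˡ-+ c _ _))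

*-suc : ∀ f g n → (f *ₛ g) (suc n) ≡ f 0 * g (suc n) ℤ.+ (tail f *ₛ g) n
*-suc f g n = sumTo-head n _

*ₛ-cong : ∀ {f f′ g g′} → f ≗ f′ → g ≗ g′ → f *ₛ g ≗ f′ *ₛ g′
*ₛ-cong p q n = sumTo-cong n λ i _ → ≡.cong₂ _*_ (p i) (q (n ∸ i))

*ₛ-distribʳ : ∀ h f g → (f +ₛ g) *ₛ h ≗ f *ₛ h +ₛ g *ₛ h
*ₛ-distribʳ h f g n = ≡.trans
  (sumTo-cong n λ i _ → ℤ.*-distribʳ-+ (h (n ∸ i)) (f i) (g i))
  (sumTo-+ n (λ i → f i * h (n ∸ i)) (λ i → g i * h (n ∸ i)))

*ₛ-scale : ∀ c f g → (c ·ₛ f) *ₛ g ≗ c ·ₛ (f *ₛ g)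
*ₛ-scale c f g n = ≡.trans
  (sumTo-cong n λ i _ → ℤ.*-assoc c (f i) (g (n ∸ i)))
  (sumTo-* n c λ i → f i * g (n ∸ i))

const-* : ∀ c f → const c *ₛ f ≗ c ·ₛ f
const-* c f zero    = ≡.refl
const-* c f (suc n) = ≡.trans (*-suc (const c) f n)
    (≡.trans (≡.cong (ℤ._+_ (c * f (suc n))) (sumTo-zero n λ i _ → ℤ.*-zeroˡ (f (n ∸ i))))
      (ℤ.+-identityʳ _))

-- Splitting off the head of each factor leaves the product of the two tails on both sides, two
-- coefficients lower; the recursion is on the coefficient index.
*ₛ-comm : ∀ f g → f *ₛ g ≗ g *ₛ f
*ₛ-comm = go
  where
  swap : ∀ a b c d e → a * b ℤ.+ (c * d ℤ.+ e) ≡ c * d ℤ.+ (a * b ℤ.+ e)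
  swap = solve-∀
  swap₀ : ∀ a b c d → a * b ℤ.+ c * d ≡ d * c ℤ.+ b * a
  swap₀ = solve-∀
  go : ∀ f g n → (f *ₛ g) n ≡ (g *ₛ f) n
  go f g zero          = ℤ.*-comm (f 0) (g 0)
  go f g (suc zero)    = swap₀ (f 0) (g 1) (f 1) (g 0)
  go f g (suc (suc n)) = begin
    (f *ₛ g) (2 ℕ.+ n)
      ≡⟨ *-suc f g (suc n) ⟩
    f 0 * g (2 ℕ.+ n) ℤ.+ (tail f *ₛ g) (suc n)
      ≡⟨ ≡.cong (ℤ._+_ (f 0 * g (2 ℕ.+ n))) (go (tail f) g (suc n)) ⟩
    f 0 * g (2 ℕ.+ n) ℤ.+ (g *ₛ tail f) (suc n)
      ≡⟨ ≡.cong (ℤ._+_ (f 0 * g (2 ℕ.+ n))) (*-suc g (tail f) n) ⟩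
    f 0 * g (2 ℕ.+ n) ℤ.+ (g 0 * f (2 ℕ.+ n) ℤ.+ (tail g *ₛ tail f) n)
      ≡⟨ swap (f 0) _ (g 0) _ _ ⟩
    g 0 * f (2 ℕ.+ n) ℤ.+ (f 0 * g (2 ℕ.+ n) ℤ.+ (tail g *ₛ tail f) n)
      ≡⟨ ≡.cong (λ z → g 0 * f (2 ℕ.+ n) ℤ.+ (f 0 * g (2 ℕ.+ n) ℤ.+ z)) (go (tail g) (tail f) n) ⟩
    g 0 * f (2 ℕ.+ n) ℤ.+ (f 0 * g (2 ℕ.+ n) ℤ.+ (tail f *ₛ tail g) n)
      ≡⟨ ≡.cong (ℤ._+_ (g 0 * f (2 ℕ.+ n))) (*-suc f (tail g) n) ⟨
    g 0 * f (2 ℕ.+ n) ℤ.+ (f *ₛ tail g) (suc n)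
      ≡⟨ ≡.cong (ℤ._+_ (g 0 * f (2 ℕ.+ n))) (go f (tail g) (suc n)) ⟩
    g 0 * f (2 ℕ.+ n) ℤ.+ (tail g *ₛ f) (suc n)
      ≡⟨ *-suc g f (suc n) ⟨
    (g *ₛ f) (2 ℕ.+ n) ∎
    where open ≡.≡-Reasoning

*ₛ-assoc : ∀ f g h → (f *ₛ g) *ₛ h ≗ f *ₛ (g *ₛ h)
*ₛ-assoc f g h = go f
  where
  regroup : ∀ a b c d e → (a * b) * c ℤ.+ (a * d ℤ.+ e) ≡ a * (b * c ℤ.+ d) ℤ.+ e
  regroup = solve-∀
  go : ∀ f n → ((f *ₛ g) *ₛ h) n ≡ (f *ₛ (g *ₛ h)) n
  go f zero    = ℤ.*-assoc (f 0) (g 0) (h 0)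
  go f (suc n) = begin
    ((f *ₛ g) *ₛ h) (suc n)
      ≡⟨ *-suc (f *ₛ g) h n ⟩
    (f 0 * g 0) * h (suc n) ℤ.+ (tail (f *ₛ g) *ₛ h) n
      ≡⟨ ≡.cong (ℤ._+_ ((f 0 * g 0) * h (suc n)))
           (≡.trans (*ₛ-cong {g = h} (*-suc f g) (λ _ → ≡.refl) n)
             (*ₛ-distribʳ h (f 0 ·ₛ tail g) (tail f *ₛ g) n)) ⟩
    (f 0 * g 0) * h (suc n) ℤ.+ (((f 0 ·ₛ tail g) *ₛ h) n ℤ.+ ((tail f *ₛ g) *ₛ h) n)
      ≡⟨ ≡.cong (ℤ._+_ ((f 0 * g 0) * h (suc n)))
           (≡.cong₂ ℤ._+_ (*ₛ-scale (f 0) (tail g) h n) (go (tail f) n)) ⟩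
    (f 0 * g 0) * h (suc n) ℤ.+ (f 0 * (tail g *ₛ h) n ℤ.+ (tail f *ₛ (g *ₛ h)) n)
      ≡⟨ regroup (f 0) (g 0) (h (suc n)) _ _ ⟩
    f 0 * (g 0 * h (suc n) ℤ.+ (tail g *ₛ h) n) ℤ.+ (tail f *ₛ (g *ₛ h)) n
      ≡⟨ ≡.cong (λ z → f 0 * z ℤ.+ (tail f *ₛ (g *ₛ h)) n) (*-suc g h n) ⟨
    f 0 * (g *ₛ h) (suc n) ℤ.+ (tail f *ₛ (g *ₛ h)) n
      ≡⟨ *-suc f (g *ₛ h) n ⟨
    (f *ₛ (g *ₛ h)) (suc n) ∎
    where open ≡.≡-Reasoning

seriesRing : CommutativeRing 0ℓ 0ℓ
seriesRing = record
  { Carrier = PowerSeries ; _≈_ = _≈_ ; _+_ = _⊕_ ; _*_ = _⊗_ ; -_ = ⊖_ ; 0# = 𝟎 ; 1# = 𝟏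
  ; isCommutativeRing = record
    { isRing = record
      { +-isAbelianGroup = record
        { isGroup = record
          { isMonoid = record
            { isSemigroup = record
              { isMagma = record
                { isEquivalence = record
                  { refl  = mk λ _ → ≡.refl
                  ; sym   = λ p → mk λ n → ≡.sym (at p n)
                  ; trans = ≈-trans
                  }
                ; ∙-cong = λ p q → mk λ n → ≡.cong₂ ℤ._+_ (at p n) (at q n)
                }
              ; assoc = λ f g h → mk λ n → ℤ.+-assoc (coeff f n) (coeff g n) (coeff h n)
              }
            ; identity = (λ f → mk λ { zero → ℤ.+-identityˡ _ ; (suc _) → ℤ.+-identityˡ _ })
                       , (λ f → mk λ { zero → ℤ.+-identityʳ _ ; (suc _) → ℤ.+-identityʳ _ })
            }
          ; inverse = (λ f → mk λ { zero    → ℤ.+-inverseˡ (coeff f 0)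
                                  ; (suc n) → ℤ.+-inverseˡ (coeff f (suc n)) })
                    , (λ f → mk λ { zero    → ℤ.+-inverseʳ (coeff f 0)
                                  ; (suc n) → ℤ.+-inverseʳ (coeff f (suc n)) })
          ; ⁻¹-cong = λ p → mk λ n → ≡.cong ℤ.-_ (at p n)
          }
        ; comm = λ f g → mk λ n → ℤ.+-comm (coeff f n) (coeff g n)
        }
      ; *-cong = λ p q → mk (*ₛ-cong (at p) (at q))
      ; *-assoc = λ f g h → mk (*ₛ-assoc (coeff f) (coeff g) (coeff h))
      ; *-identity = identityˡ , λ f → ≈-trans (comm f 𝟏) (identityˡ f)
      ; distrib = (λ h f g → ≈-trans (comm h (f ⊕ g)) (≈-trans (distribʳ h f g)
                    (mk λ n → ≡.cong₂ ℤ._+_ (at (comm f h) n) (at (comm g h) n))))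
                , distribʳ
      }
    ; *-comm = comm
    }
  }
  where
  ≈-trans : ∀ {f g h} → f ≈ g → g ≈ h → f ≈ h
  ≈-trans p q = mk λ n → ≡.trans (at p n) (at q n)
  comm : ∀ f g → f ⊗ g ≈ g ⊗ f
  comm f g = mk (*ₛ-comm (coeff f) (coeff g))
  distribʳ : ∀ h f g → (f ⊕ g) ⊗ h ≈ f ⊗ h ⊕ g ⊗ h
  distribʳ h f g = mk (*ₛ-distribʳ (coeff h) (coeff f) (coeff g))
  identityˡ : ∀ f → 𝟏 ⊗ f ≈ f
  identityˡ f = mk λ n → ≡.trans (const-* (+ 1) (coeff f) n) (ℤ.*-identityˡ (coeff f n))

open CommutativeRing seriesRing
  using (setoid; refl; sym; trans; reflexive; +-cong; +-congˡ; +-congʳ; *-cong; *-congˡ; *-congʳ;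
         -‿cong; +-assoc; *-assoc; *-comm; *-identityˡ; *-identityʳ; zeroˡ; +-identityˡ; +-identityʳ)
open import Relation.Binary.Reasoning.Setoid setoid

-- Integer coefficients give the ring solver numerals such as 2 and 3 with a decidable equality,
-- which series do not have.
constHom : CommutativeRing.rawRing ℤ.+-*-commutativeRing
           -Raw-AlmostCommutative⟶ fromCommutativeRing seriesRing
constHom = record
  { ⟦_⟧    = constant
  ; +-homo = λ a b → mk λ { zero → ≡.refl ; (suc _) → ≡.refl }
  ; *-homo = λ a b → mk λ n → ≡.sym (≡.trans (const-* a (const b) n) (scale-const a b n))
  ; -‿homo = λ a → mk λ { zero → ≡.refl ; (suc _) → ≡.refl }
  ; 0-homo = refl
  ; 1-homo = refl
  }
  where
  scale-const : ∀ a b n → (a ·ₛ const b) n ≡ const (a * b) n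
  scale-const a b zero    = ≡.refl
  scale-const a b (suc _) = ℤ.*-zeroʳ a

const≟ : ∀ a b → Maybe (constant a ≈ constant b)
const≟ a b with a ℤ.≟ b
... | yes a≡b = just (reflexive (≡.cong constant a≡b))
... | no  _   = nothing

open RingSolver (CommutativeRing.rawRing ℤ.+-*-commutativeRing)
  (fromCommutativeRing seriesRing) constHom const≟
  using (Polynomial; solve; _:=_; _:+_; _:*_; :-_; con)

:0 :1 :2 :3 : ∀ {n} → Polynomial n
:0 = con (+ 0)
:1 = con (+ 1)
:2 = con (+ 2)
:3 = con (+ 3)

-- Congruence modulo q^n and convergence

infix 4 _≈[_]_ _⇝_

record _≈[_]_ (f : PowerSeries) (n : ℕ) (g : PowerSeries) : Set where
  constructor mkₙ
  field below : ∀ i → i ℕ.< n → coeff f i ≡ coeff g i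
open _≈[_]_

module _ {n : ℕ} where

  fromEq : ∀ {f g} → f ≈ g → f ≈[ n ] g
  fromEq p = mkₙ λ i _ → at p i

  mod-sym : ∀ {f g} → f ≈[ n ] g → g ≈[ n ] f
  mod-sym p = mkₙ λ i i<n → ≡.sym (below p i i<n)

  mod-trans : ∀ {f g h} → f ≈[ n ] g → g ≈[ n ] h → f ≈[ n ] h
  mod-trans p r = mkₙ λ i i<n → ≡.trans (below p i i<n) (below r i i<n)

  mod-weaken : ∀ {m f g} → m ℕ.≤ n → f ≈[ n ] g → f ≈[ m ] g
  mod-weaken m≤n p = mkₙ λ i i<m → below p i (ℕ.≤-trans i<m m≤n)

  mod-+ : ∀ {f f′ g g′} → f ≈[ n ] f′ → g ≈[ n ] g′ → f ⊕ g ≈[ n ] f′ ⊕ g′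
  mod-+ p r = mkₙ λ i i<n → ≡.cong₂ ℤ._+_ (below p i i<n) (below r i i<n)

  mod-neg : ∀ {f f′} → f ≈[ n ] f′ → ⊖ f ≈[ n ] ⊖ f′
  mod-neg p = mkₙ λ i i<n → ≡.cong ℤ.-_ (below p i i<n)

  mod-* : ∀ {f f′ g g′} → f ≈[ n ] f′ → g ≈[ n ] g′ → f ⊗ g ≈[ n ] f′ ⊗ g′
  mod-* p r = mkₙ λ i i<n → sumTo-cong i λ j j≤i → ≡.cong₂ _*_
    (below p j (ℕ.≤-<-trans j≤i i<n)) (below r (i ∸ j) (ℕ.≤-<-trans (ℕ.m∸n≤m i j) i<n))

  mod-*ˡ : ∀ {f f′} g → f ≈[ n ] f′ → f ⊗ g ≈[ n ] f′ ⊗ g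
  mod-*ˡ g p = mod-* p (fromEq refl)

  zero-*ˡ : ∀ {f} g → f ≈[ n ] 𝟎 → f ⊗ g ≈[ n ] 𝟎
  zero-*ˡ g p = mod-trans (mod-*ˡ g p) (fromEq (zeroˡ g))

-- Convergence with a fixed rate: the n-th term already agrees with the limit below q^n. No modulus
-- has to be carried through sums and products, and passing to indices that are at least n preserves
-- the limit.
record _⇝_ (A : ℕ → PowerSeries) (L : PowerSeries) : Set where
  constructor lim
  field near : ∀ n → A n ≈[ n ] L
open _⇝_

⇝-const : ∀ {f} → (λ _ → f) ⇝ f
⇝-const = lim λ _ → fromEq refl

⇝-+ : ∀ {A B f g} → A ⇝ f → B ⇝ g → (λ n → A n ⊕ B n) ⇝ f ⊕ g
⇝-+ p r = lim λ n → mod-+ (near p n) (near r n)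

⇝-* : ∀ {A B f g} → A ⇝ f → B ⇝ g → (λ n → A n ⊗ B n) ⇝ f ⊗ g
⇝-* p r = lim λ n → mod-* (near p n) (near r n)

⇝-cong : ∀ {A B f g} → (∀ n → A n ≈ B n) → f ≈ g → A ⇝ f → B ⇝ g
⇝-cong A≈B f≈g p =
  lim λ n → mod-trans (fromEq (sym (A≈B n))) (mod-trans (near p n) (fromEq f≈g))

⇝-subseq : ∀ {A f} (φ : ℕ → ℕ) → (∀ n → n ℕ.≤ φ n) → A ⇝ f → (λ n → A (φ n)) ⇝ f
⇝-subseq φ n≤φn p = lim λ n → mod-weaken (n≤φn n) (near p (φ n))

⇝-unique : ∀ {A B f g} → (∀ n → A n ≈ B n) → A ⇝ f → B ⇝ g → f ≈ g
⇝-unique A≈B p r = mk λ i →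
  below (mod-trans (mod-sym (near p (suc i))) (mod-trans (fromEq (A≈B (suc i))) (near r (suc i))))
    i ℕ.≤-refl

Small : (ℕ → PowerSeries) → Set
Small F = ∀ n → F n ≈[ n ] 𝟎

Small-*ˡ : ∀ {F} (G : ℕ → PowerSeries) → Small F → Small λ n → F n ⊗ G n
Small-*ˡ G s n = zero-*ˡ (G n) (s n)

Small-*ʳ : ∀ {F} (G : ℕ → PowerSeries) → Small F → Small λ n → G n ⊗ F n
Small-*ʳ {F} G s n = mod-trans (fromEq (*-comm (G n) (F n))) (zero-*ˡ (G n) (s n))

Small-+ : ∀ {F G} → Small F → Small G → Small λ n → F n ⊕ G n
Small-+ s t n = mod-trans (mod-+ (s n) (t n)) (fromEq (+-identityˡ 𝟎))

-- Infinite sums as limits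

∑∞ : (ℕ → PowerSeries) → PowerSeries
coeff (∑∞ F) = infSum (coeff ∘ F)

partialSum : (ℕ → PowerSeries) → ℕ → PowerSeries
partialSum F zero    = 𝟎
partialSum F (suc n) = partialSum F n ⊕ F n

-- `infSum` truncates along the diagonal: coefficient i uses the terms 0 to i. Smallness makes all
-- later terms vanish at that coefficient.
partialSum⇝∑∞ : ∀ {F} → Small F → partialSum F ⇝ ∑∞ F
partialSum⇝∑∞ {F} s = lim λ n → mkₙ λ i i<n → go n i i<n
  where
  coefficients : ∀ n i → coeff (partialSum F (suc n)) i ≡ sumTo n λ m → coeff (F m) i
  coefficients zero    i = at (+-identityˡ (F 0)) i
  coefficients (suc n) i = ≡.cong (ℤ._+ coeff (F (suc n)) i) (coefficients n i)
  𝟎-at : ∀ i → coeff 𝟎 i ≡ + 0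
  𝟎-at zero    = ≡.refl
  𝟎-at (suc _) = ≡.refl
  go : ∀ n i → i ℕ.< n → coeff (partialSum F n) i ≡ coeff (∑∞ F) i
  go (suc n) i i<1+n with ℕ.m<1+n⇒m<n∨m≡n i<1+n
  ... | inj₂ ≡.refl = coefficients i i
  ... | inj₁ i<n    = ≡.trans
    (≡.cong₂ ℤ._+_ (go n i i<n) (≡.trans (below (s n) i i<n) (𝟎-at i))) (ℤ.+-identityʳ _)

∑∞-cong : ∀ {F G} → (∀ n → F n ≈ G n) → ∑∞ F ≈ ∑∞ G
∑∞-cong p = mk λ i → sumTo-cong i λ n _ → at (p n) i

-- Each coefficient is a finite sum, so a congruence uniform in the summation index passes to the
-- sums. This is what allows a parameter to tend to infinity under the summation sign.
∑∞-mod : ∀ {k F G} → (∀ n → F n ≈[ k ] G n) → ∑∞ F ≈[ k ] ∑∞ G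
∑∞-mod p = mkₙ λ i i<k → sumTo-cong i λ n _ → below (p n) i i<k

partialSum-cong : ∀ {F G} n → (∀ m → F m ≈ G m) → partialSum F n ≈ partialSum G n
partialSum-cong zero    p = refl
partialSum-cong (suc n) p = +-cong (partialSum-cong n p) (p n)

partialSum-linear : ∀ a b F G n →
  partialSum (λ m → a ⊗ F m ⊕ b ⊗ G m) n ≈ a ⊗ partialSum F n ⊕ b ⊗ partialSum G n
partialSum-linear a b F G zero = solve 2 (λ a b → :0 := a :* :0 :+ b :* :0) refl a b
partialSum-linear a b F G (suc n) = trans (+-congʳ (partialSum-linear a b F G n))
  (solve 6 (λ a b f g F G → (a :* F :+ b :* G) :+ (a :* f :+ b :* g) := a :* (F :+ f) :+ b :* (G :+ g))
    refl a b (F n) (G n) (partialSum F n) (partialSum G n))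

∑∞-linear : ∀ a b {F G} → Small F → Small G →
  ∑∞ (λ m → a ⊗ F m ⊕ b ⊗ G m) ≈ a ⊗ ∑∞ F ⊕ b ⊗ ∑∞ G
∑∞-linear a b {F} {G} s t = ⇝-unique (partialSum-linear a b F G)
  (partialSum⇝∑∞ (Small-+ (Small-*ʳ (λ _ → a) s) (Small-*ʳ (λ _ → b) t)))
  (⇝-+ (⇝-* ⇝-const (partialSum⇝∑∞ s)) (⇝-* ⇝-const (partialSum⇝∑∞ t)))

∑∞-scale : ∀ a {F} → Small F → ∑∞ (λ m → a ⊗ F m) ≈ a ⊗ ∑∞ F
∑∞-scale a {F} s = begin
  ∑∞ (λ m → a ⊗ F m)
    ≈⟨ ∑∞-cong (λ m → solve 2 (λ a f → a :* f := a :* f :+ :0 :* f) refl a (F m)) ⟩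
  ∑∞ (λ m → a ⊗ F m ⊕ 𝟎 ⊗ F m)
    ≈⟨ ∑∞-linear a 𝟎 s s ⟩
  a ⊗ ∑∞ F ⊕ 𝟎 ⊗ ∑∞ F
    ≈⟨ solve 2 (λ a f → a :* f :+ :0 :* f := a :* f) refl a (∑∞ F) ⟩
  a ⊗ ∑∞ F ∎

partialSum-telescope : ∀ (t K : ℕ → PowerSeries) → (∀ n → t n ⊕ K (suc n) ≈ K n) →
  ∀ n → partialSum t n ⊕ K n ≈ K 0
partialSum-telescope t K step zero    = +-identityˡ _
partialSum-telescope t K step (suc n) = trans
  (solve 3 (λ s t k → (s :+ t) :+ k := s :+ (t :+ k)) refl (partialSum t n) (t n) (K (suc n)))
  (trans (+-congˡ (step n)) (partialSum-telescope t K step n))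

∑∞-telescope : ∀ (t K : ℕ → PowerSeries) {L} →
  Small t → (∀ n → t n ⊕ K (suc n) ≈ K n) → K ⇝ L → ∑∞ t ⊕ L ≈ K 0
∑∞-telescope t K s step K⇝L =
  ⇝-unique (partialSum-telescope t K step) (⇝-+ (partialSum⇝∑∞ s) K⇝L) ⇝-const

-- Inverses

-- The recursion for coefficient n + 1 evaluates every earlier coefficient with fuel n, whereas
-- `inv` evaluates it with fuel equal to its own index; this lemma reconciles the two.
invAux-fuel : ∀ f k l n → n ℕ.≤ k → n ℕ.≤ l → invAux f k n ≡ invAux f l n
invAux-fuel f k       l       zero    _         _         = ≡.refl
invAux-fuel f (suc k) (suc l) (suc n) (s≤s n≤k) (s≤s n≤l) =
  ≡.cong ℤ.-_ (sumTo-cong n λ i _ → ≡.cong (f (suc i) *_)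
    (invAux-fuel f k l (n ∸ i) (ℕ.≤-trans (ℕ.m∸n≤m n i) n≤k) (ℕ.≤-trans (ℕ.m∸n≤m n i) n≤l)))

recip : PowerSeries → PowerSeries
coeff (recip f) = inv (coeff f)

recip-inverse : ∀ {f} → coeff f 0 ≡ + 1 → f ⊗ recip f ≈ 𝟏
recip-inverse {f} f₀≡1 = mk go
  where
  a : Series
  a = coeff f
  cancel : ∀ x → + 1 * ℤ.- x ℤ.+ x ≡ + 0
  cancel = solve-∀
  go : ∀ n → (a *ₛ inv a) n ≡ const (+ 1) n
  go zero    = ≡.cong (_* + 1) f₀≡1
  go (suc n) = ≡.trans (*-suc a (inv a) n) (≡.trans
    (≡.cong₂ (λ x y → x * ℤ.- sumTo n (λ i → a (suc i) * invAux a n (n ∸ i)) ℤ.+ y) f₀≡1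
      (sumTo-cong n λ i _ → ≡.cong (a (suc i) *_)
        (invAux-fuel a (n ∸ i) n (n ∸ i) ℕ.≤-refl (ℕ.m∸n≤m n i))))
    (cancel (sumTo n λ i → a (suc i) * invAux a n (n ∸ i))))

inverse-unique : ∀ {f g h} → f ⊗ g ≈ 𝟏 → f ⊗ h ≈ 𝟏 → g ≈ h
inverse-unique {f} {g} {h} fg≈1 fh≈1 = begin
  g               ≈⟨ solve 1 (λ g → g := :1 :* g) refl g ⟩
  𝟏 ⊗ g         ≈⟨ *-congʳ fh≈1 ⟨
  (f ⊗ h) ⊗ g   ≈⟨ solve 3 (λ f g h → (f :* h) :* g := (f :* g) :* h) refl f g h ⟩
  (f ⊗ g) ⊗ h   ≈⟨ *-congʳ fg≈1 ⟩
  𝟏 ⊗ h         ≈⟨ *-identityˡ h ⟩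
  h               ∎

-- Write B n as f g B n. Modulo q^n the factor f may be replaced by A n, which cancels B n and
-- leaves g.
⇝-inverse : ∀ {A B f g} → A ⇝ f → (∀ n → A n ⊗ B n ≈ 𝟏) → f ⊗ g ≈ 𝟏 → B ⇝ g
⇝-inverse {A} {B} {f} {g} A⇝f AB≈1 fg≈1 = lim λ n →
  mod-trans (fromEq (begin
      B n                 ≈⟨ solve 1 (λ b → b := :1 :* b) refl (B n) ⟩
      𝟏 ⊗ B n           ≈⟨ *-congʳ fg≈1 ⟨
      (f ⊗ g) ⊗ B n     ≈⟨ *-assoc f g (B n) ⟩
      f ⊗ (g ⊗ B n)     ∎))
  (mod-trans (mod-*ˡ (g ⊗ B n) (mod-sym (near A⇝f n))) (fromEq (begin
      A n ⊗ (g ⊗ B n)   ≈⟨ solve 3 (λ a b g → a :* (g :* b) := (a :* b) :* g) refl (A n) (B n) g ⟩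
      (A n ⊗ B n) ⊗ g   ≈⟨ *-congʳ (AB≈1 n) ⟩
      𝟏 ⊗ g             ≈⟨ *-identityˡ g ⟩
      g                   ∎)))

-- Powers of q and q-shifted factorials

q Q : PowerSeries
q = ⟪ qpow 1 ⟫
Q = q ⊗ q

pow : PowerSeries → ℕ → PowerSeries
pow S zero    = 𝟏
pow S (suc n) = S ⊗ pow S n

pow-+ : ∀ S m n → pow S (m ℕ.+ n) ≈ pow S m ⊗ pow S n
pow-+ S zero    n = sym (*-identityˡ _)
pow-+ S (suc m) n = trans (*-congˡ (pow-+ S m n)) (sym (*-assoc _ _ _))

pow-* : ∀ S n s → pow S (n ℕ.* s) ≈ pow (pow S s) n
pow-* S zero    s = refl
pow-* S (suc n) s = trans (pow-+ S s (n ℕ.* s)) (*-congˡ (pow-* S n s))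

pow-cong : ∀ {S T} n → S ≈ T → pow S n ≈ pow T n
pow-cong zero    S≈T = refl
pow-cong (suc n) S≈T = *-cong S≈T (pow-cong n S≈T)

pow-⊗ : ∀ S T n → pow (S ⊗ T) n ≈ pow S n ⊗ pow T n
pow-⊗ S T zero    = sym (*-identityˡ 𝟏)
pow-⊗ S T (suc n) = trans (*-congˡ (pow-⊗ S T n))
  (solve 4 (λ s t x y → s :* t :* (x :* y) := s :* x :* (t :* y)) refl S T (pow S n) (pow T n))

-- Even indices are written `n * 2` because this reduces to `2 + n * 2` at a successor, so shifts by
-- two in the recurrences hold definitionally.
pow-double : ∀ n → pow q (n ℕ.* 2) ≈ pow Q n
pow-double n = trans (pow-* q n 2) (pow-cong n (*-congˡ (*-identityʳ q)))

coeff-q⊗ : ∀ f n → coeff (q ⊗ f) (suc n) ≡ coeff f n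
coeff-q⊗ f n = ≡.trans (*-suc (qpow 1) (coeff f) n) (≡.trans (ℤ.+-identityˡ _)
  (≡.trans (*ₛ-cong {g = coeff f} tail-qpow (λ _ → ≡.refl) n) (at (*-identityˡ f) n)))
  where
  tail-qpow : tail (qpow 1) ≗ const (+ 1)
  tail-qpow zero    = ≡.refl
  tail-qpow (suc _) = ≡.refl

qpow≈pow : ∀ k → ⟪ qpow k ⟫ ≈ pow q k
qpow≈pow zero    = mk λ { zero → ≡.refl ; (suc _) → ≡.refl }
qpow≈pow (suc k) = trans
  (mk λ { zero → ≡.refl ; (suc n) → ≡.sym (coeff-q⊗ ⟪ qpow k ⟫ n) })
  (*-congˡ (qpow≈pow k))

q⊗-mod : ∀ {n f} → f ≈[ n ] 𝟎 → q ⊗ f ≈[ suc n ] 𝟎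
q⊗-mod {n} {f} p = mkₙ go
  where
  zero-at : ∀ i → coeff 𝟎 i ≡ coeff 𝟎 (suc i)
  zero-at zero    = ≡.refl
  zero-at (suc _) = ≡.refl
  go : ∀ i → i ℕ.< suc n → coeff (q ⊗ f) i ≡ coeff 𝟎 i
  go zero    _         = ≡.refl
  go (suc i) (s≤s i<n) = ≡.trans (coeff-q⊗ f i) (≡.trans (below p i i<n) (zero-at i))

Small-pow : Small (pow q)
Small-pow zero    = mkₙ λ _ ()
Small-pow (suc n) = q⊗-mod (Small-pow n)

Small-powQ : Small (pow Q)
Small-powQ n = mod-trans (fromEq (sym (pow-double n))) (mod-weaken (ℕ.m≤m*n n 2) (Small-pow (n ℕ.* 2)))

-- Parameter and base are arbitrary series, so that one definition covers -q, q² and q^(2m+2) as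
-- arguments and the substitution q ↦ -q can act on them.
poc : PowerSeries → PowerSeries → ℕ → PowerSeries
poc A S zero    = 𝟏
poc A S (suc n) = poc A S n ⊗ (𝟏 ⊕ ⊖ (A ⊗ pow S n))

poc-cong : ∀ {A B S T} → A ≈ B → S ≈ T → ∀ n → poc A S n ≈ poc B T n
poc-cong A≈B S≈T zero    = refl
poc-cong A≈B S≈T (suc n) =
  *-cong (poc-cong A≈B S≈T n) (+-congˡ (-‿cong (*-cong A≈B (pow-cong n S≈T))))

poc-+ : ∀ A S m n → poc A S (m ℕ.+ n) ≈ poc A S m ⊗ poc (A ⊗ pow S m) S n
poc-+ A S m zero    = trans (reflexive (≡.cong (poc A S) (ℕ.+-identityʳ m))) (sym (*-identityʳ _))
poc-+ A S m (suc n) = begin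
  poc A S (m ℕ.+ suc n)
    ≈⟨ reflexive (≡.cong (poc A S) (ℕ.+-suc m n)) ⟩
  poc A S (m ℕ.+ n) ⊗ (𝟏 ⊕ ⊖ (A ⊗ pow S (m ℕ.+ n)))
    ≈⟨ *-cong (poc-+ A S m n) (+-congˡ (-‿cong (*-congˡ (pow-+ S m n)))) ⟩
  poc A S m ⊗ poc (A ⊗ pow S m) S n ⊗ (𝟏 ⊕ ⊖ (A ⊗ (pow S m ⊗ pow S n)))
    ≈⟨ solve 5 (λ p r a s t → p :* r :* (:1 :+ :- (a :* (s :* t)))
                            := p :* (r :* (:1 :+ :- (a :* s :* t))))
         refl (poc A S m) (poc (A ⊗ pow S m) S n) A (pow S m) (pow S n) ⟩
  poc A S m ⊗ (poc (A ⊗ pow S m) S n ⊗ (𝟏 ⊕ ⊖ (A ⊗ pow S m ⊗ pow S n))) ∎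

factor : ℤ → ℕ → Series
factor c k = const (+ 1) -ₛ c ·ₛ qpow k

factor≈ : ∀ c k → ⟪ factor c k ⟫ ≈ 𝟏 ⊕ ⊖ (constant c ⊗ pow q k)
factor≈ c k = trans (mk λ n → ≡.cong (λ z → const (+ 1) n ℤ.+ ℤ.- z) (≡.sym (const-* c (qpow k) n)))
  (+-congˡ {𝟏} (-‿cong {constant c ⊗ ⟪ qpow k ⟫} (*-congˡ (qpow≈pow k))))

poch≈poc : ∀ c a s n → ⟪ poch c a s n ⟫ ≈ poc (constant c ⊗ pow q a) (pow q s) n
poch≈poc c a s zero    = mk λ _ → ≡.refl
poch≈poc c a s (suc n) = trans {j = ⟪ poch c a s n ⟫ ⊗ ⟪ factor c (a ℕ.+ n ℕ.* s) ⟫} (mk λ _ → ≡.refl)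
  (*-cong (poch≈poc c a s n) (trans (factor≈ c (a ℕ.+ n ℕ.* s)) (+-congˡ (-‿cong
    (trans (*-congˡ (trans (pow-+ q a (n ℕ.* s)) (*-congˡ (pow-* q n s)))) (sym (*-assoc _ _ _)))))))

-- As a ≥ 1 and the exponents grow by at least 1, factor j is 1 modulo q^(j+1). Coefficient i is
-- therefore settled after i + 1 factors, which is where `infProd` reads it.
poch⇝pochInf : ∀ c a s → 1 ℕ.≤ a → (λ n → ⟪ poch c a (suc s) n ⟫) ⇝ ⟪ pochInf c a (suc s) ⟫
poch⇝pochInf c a s 1≤a = lim λ n → mkₙ λ i i<n → below (stable (ℕ.≤⇒≤‴ i<n)) i ℕ.≤-refl
  where
  P : ℕ → PowerSeries
  P n = ⟪ poch c a (suc s) n ⟫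
  exponent : ℕ → ℕ
  exponent j = a ℕ.+ j ℕ.* suc s
  factor-trivial : ∀ j → ⟪ factor c (exponent j) ⟫ ≈[ suc j ] 𝟏
  factor-trivial j = mod-trans (fromEq (factor≈ c (exponent j))) (mod-trans
    (mod-+ (fromEq refl) (mod-neg (mod-trans (fromEq (*-comm _ _)) (zero-*ˡ (constant c)
      (mod-weaken (ℕ.+-mono-≤ 1≤a (ℕ.m≤m*n j (suc s))) (Small-pow (exponent j)))))))
    (fromEq (solve 0 (:1 :+ :- :0 := :1) refl)))
  step : ∀ n → P (suc n) ≈[ n ] P n
  step n = mod-trans (fromEq {g = P n ⊗ ⟪ factor c (exponent n) ⟫} (mk λ _ → ≡.refl))
    (mod-trans (mod-* (fromEq refl) (mod-weaken (ℕ.n≤1+n n) (factor-trivial n)))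
      (fromEq (*-identityʳ (P n))))
  stable : ∀ {m n} → m ℕ.≤‴ n → P n ≈[ m ] P m
  stable ℕ.≤‴-refl       = fromEq refl
  stable (ℕ.≤‴-step m<n) = mod-trans (mod-weaken (ℕ.n≤1+n _) (stable m<n)) (step _)

coeff-poc : ∀ A S n → coeff A 0 ≡ + 0 → coeff (poc A S n) 0 ≡ + 1
coeff-poc A S zero    A₀≡0 = ≡.refl
coeff-poc A S (suc n) A₀≡0 =
  ≡.cong₂ (λ x y → x * (+ 1 ℤ.- y * coeff (pow S n) 0)) (coeff-poc A S n A₀≡0) A₀≡0

1/poc : PowerSeries → PowerSeries → ℕ → PowerSeries
1/poc A S n = recip (poc A S n)

1/poc-inverse : ∀ A S n → coeff A 0 ≡ + 0 → poc A S n ⊗ 1/poc A S n ≈ 𝟏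
1/poc-inverse A S n A₀≡0 = recip-inverse (coeff-poc A S n A₀≡0)

1/poc-zero : ∀ A S → coeff A 0 ≡ + 0 → 1/poc A S 0 ≈ 𝟏
1/poc-zero A S A₀≡0 = inverse-unique (1/poc-inverse A S 0 A₀≡0) (*-identityˡ 𝟏)

-- Stated from n up to n + 1 so that all reciprocals in an identity can be raised to the largest
-- index present, leaving a polynomial identity.
1/poc-step : ∀ A S n → coeff A 0 ≡ + 0 → 1/poc A S n ≈ 1/poc A S (suc n) ⊗ (𝟏 ⊕ ⊖ (A ⊗ pow S n))
1/poc-step A S n A₀≡0 = inverse-unique (1/poc-inverse A S n A₀≡0) (trans
  (solve 3 (λ p r f → p :* (r :* f) := p :* f :* r) refl (poc A S n) (1/poc A S (suc n)) _)
  (1/poc-inverse A S (suc n) A₀≡0))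

-- The substitution q ↦ −q

sign-power : ℕ → ℤ
sign-power zero    = + 1
sign-power (suc n) = ℤ.- sign-power n

sign-power-+ : ∀ m n → sign-power m * sign-power n ≡ sign-power (m ℕ.+ n)
sign-power-+ zero    n = ℤ.*-identityˡ _
sign-power-+ (suc m) n =
  ≡.trans (≡.sym (ℤ.neg-distribˡ-* (sign-power m) (sign-power n))) (≡.cong ℤ.-_ (sign-power-+ m n))

-- The sign function local to negq has no name outside Defs, and inside negq f n
-- its parameter n coincides with its argument.  Abstracting suc n separates the
-- two, and abstracting the surrounding operations exposes the sign to unification.
mutual
  localSign : Series → ℕ → ℕ → ℤ
  localSign = _

  localSign-spec : ∀ f n → negq f (suc n) ≡ ℤ.- localSign f (suc n) n * f (suc n)
  localSign-spec f n with suc n | ℤ.-_ | ∣_∣ | ℤ.sign | ℕ._*_ | Sign._*_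
  ... | _ | _ | _ | _ | _ | _ = ≡.refl

localSign≡ : ∀ f k n → localSign f k n ≡ sign-power n
localSign≡ f k zero    = ≡.refl
localSign≡ f k (suc n) = ≡.cong ℤ.-_ (localSign≡ f k n)

negq≡ : ∀ f n → negq f n ≡ sign-power n * f n
negq≡ f zero    = ≡.refl
negq≡ f (suc n) =
  ≡.trans (localSign-spec f n) (≡.cong (λ s → ℤ.- s * f (suc n)) (localSign≡ f (suc n) n))

σ : PowerSeries → PowerSeries
coeff (σ f) n = sign-power n * coeff f n

σ-cong : ∀ {f g} → f ≈ g → σ f ≈ σ g
σ-cong p = mk λ n → ≡.cong (sign-power n *_) (at p n)

σ-𝟏 : σ 𝟏 ≈ 𝟏
σ-𝟏 = mk λ { zero → ≡.refl ; (suc n) → ℤ.*-zeroʳ (sign-power (suc n)) }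

σ-q : σ q ≈ ⊖ q
σ-q = mk λ where
  zero          → ≡.refl
  (suc zero)    → ≡.refl
  (suc (suc n)) → ℤ.*-zeroʳ (sign-power (suc (suc n)))

σ-⊕ : ∀ f g → σ (f ⊕ g) ≈ σ f ⊕ σ g
σ-⊕ f g = mk λ n → ℤ.*-distribˡ-+ (sign-power n) (coeff f n) (coeff g n)

σ-⊖ : ∀ f → σ (⊖ f) ≈ ⊖ σ f
σ-⊖ f = mk λ n → ≡.sym (ℤ.neg-distribʳ-* (sign-power n) (coeff f n))

σ-⊗ : ∀ f g → σ (f ⊗ g) ≈ σ f ⊗ σ g
σ-⊗ f g = mk λ n → ≡.trans (≡.sym (sumTo-* n (sign-power n) λ i → coeff f i * coeff g (n ∸ i)))
  (sumTo-cong n λ i i≤n → ≡.trans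
    (≡.cong (_* (coeff f i * coeff g (n ∸ i)))
      (≡.trans (≡.cong sign-power (≡.sym (ℕ.m+[n∸m]≡n i≤n))) (≡.sym (sign-power-+ i (n ∸ i)))))
    (interchange (sign-power i) (sign-power (n ∸ i)) (coeff f i) (coeff g (n ∸ i))))
  where
  interchange : ∀ a b c d → (a * b) * (c * d) ≡ (a * c) * (b * d)
  interchange = solve-∀

σ-∑∞ : ∀ F → σ (∑∞ F) ≈ ∑∞ λ m → σ (F m)
σ-∑∞ F = mk λ n → ≡.sym (sumTo-* n (sign-power n) λ m → coeff (F m) n)

σ-pow : ∀ S n → σ (pow S n) ≈ pow (σ S) n
σ-pow S zero    = σ-𝟏
σ-pow S (suc n) = trans (σ-⊗ S (pow S n)) (*-congˡ (σ-pow S n))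

σ-poc : ∀ A S n → σ (poc A S n) ≈ poc (σ A) (σ S) n
σ-poc A S zero    = σ-𝟏
σ-poc A S (suc n) = trans (σ-⊗ _ _) (*-cong (σ-poc A S n) (trans (σ-⊕ _ _) (+-cong σ-𝟏
  (trans (σ-⊖ _) (-‿cong (trans (σ-⊗ _ _) (*-congˡ (σ-pow S n))))))))

-- Telescoping series identities

e pQ r s o : ℕ → PowerSeries
e  = pow Q
pQ = poc Q Q
r  = 1/poc (⊖ q) q
s  = 1/poc (⊖ Q) Q
o  = 1/poc (⊖ q) Q

pp∞ pQ∞ pm∞ r∞ s∞ o∞ : PowerSeries
pp∞ = ⟪ pochInf (+ 1) 1 1 ⟫
pQ∞ = ⟪ pochInf (+ 1) 2 2 ⟫
pm∞ = ⟪ pochInf (ℤ.- + 1) 1 1 ⟫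
r∞  = recip pm∞
s∞  = recip ⟪ pochInf (ℤ.- + 1) 2 2 ⟫
o∞  = recip ⟪ pochInf (ℤ.- + 1) 1 2 ⟫

pow-1 : pow q 1 ≈ q
pow-1 = *-identityʳ q

pow-2 : pow q 2 ≈ Q
pow-2 = *-congˡ pow-1

poc⇝ : ∀ c a s {A S} → 1 ℕ.≤ a → constant c ⊗ pow q a ≈ A → pow q (suc s) ≈ S →
  poc A S ⇝ ⟪ pochInf c a (suc s) ⟫
poc⇝ c a s 1≤a A≈ S≈ = ⇝-cong
  (λ n → trans (poch≈poc c a (suc s) n) (poc-cong A≈ S≈ n)) refl (poch⇝pochInf c a s 1≤a)

minus-one : ∀ f → constant (ℤ.- + 1) ⊗ f ≈ ⊖ f
minus-one = solve 1 (λ f → con (ℤ.- + 1) :* f := :- f) refl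

pp⇝ : poc q q ⇝ pp∞
pp⇝ = poc⇝ (+ 1) 1 0 ℕ.≤-refl (trans (*-identityˡ _) pow-1) pow-1

pQ⇝ : pQ ⇝ pQ∞
pQ⇝ = poc⇝ (+ 1) 2 1 (s≤s z≤n) (trans (*-identityˡ _) pow-2) pow-2

pm⇝ : poc (⊖ q) q ⇝ pm∞
pm⇝ = poc⇝ (ℤ.- + 1) 1 0 ℕ.≤-refl (trans (minus-one _) (-‿cong pow-1)) pow-1

1/poc⇝ : ∀ {A S f} → coeff A 0 ≡ + 0 → coeff f 0 ≡ + 1 → poc A S ⇝ f → 1/poc A S ⇝ recip f
1/poc⇝ {A} {S} A₀≡0 f₀≡1 p = ⇝-inverse p (λ n → 1/poc-inverse A S n A₀≡0) (recip-inverse f₀≡1)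

r⇝ : r ⇝ r∞
r⇝ = 1/poc⇝ ≡.refl ≡.refl pm⇝

s⇝ : s ⇝ s∞
s⇝ = 1/poc⇝ ≡.refl ≡.refl
  (poc⇝ (ℤ.- + 1) 2 1 (s≤s z≤n) (trans (minus-one _) (-‿cong pow-2)) pow-2)

o⇝ : o ⇝ o∞
o⇝ = 1/poc⇝ ≡.refl ≡.refl
  (poc⇝ (ℤ.- + 1) 1 1 ℕ.≤-refl (trans (minus-one _) (-‿cong pow-1)) pow-2)

e⇝ : e ⇝ 𝟎
e⇝ = lim Small-powQ

r-even⇝ : (λ n → r (n ℕ.* 2)) ⇝ r∞
r-even⇝ = ⇝-subseq _ (λ n → ℕ.m≤m*n n 2) r⇝

r-odd⇝ : (λ n → r (1 ℕ.+ n ℕ.* 2)) ⇝ r∞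
r-odd⇝ = ⇝-subseq _ (λ n → ℕ.m≤n⇒m≤1+n (ℕ.m≤m*n n 2)) r⇝

r-even-step : ∀ n → r (n ℕ.* 2) ≈ r (1 ℕ.+ n ℕ.* 2) ⊗ (𝟏 ⊕ q ⊗ e n)
r-even-step n = trans (1/poc-step (⊖ q) q (n ℕ.* 2) ≡.refl) (*-congˡ (+-congˡ (trans
  (solve 2 (λ q x → :- (:- q :* x) := q :* x) refl q (pow q (n ℕ.* 2))) (*-congˡ (pow-double n)))))

r-odd-step : ∀ n → r (1 ℕ.+ n ℕ.* 2) ≈ r (2 ℕ.+ n ℕ.* 2) ⊗ (𝟏 ⊕ Q ⊗ e n)
r-odd-step n = trans (1/poc-step (⊖ q) q (1 ℕ.+ n ℕ.* 2) ≡.refl) (*-congˡ (+-congˡ (trans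
  (solve 2 (λ q x → :- (:- q :* (q :* x)) := q :* q :* x) refl q (pow q (n ℕ.* 2)))
  (*-congˡ (pow-double n)))))

pQ-split : ∀ n → pQ n ≈ poc q q n ⊗ poc (⊖ q) q n
pQ-split zero    = sym (*-identityˡ 𝟏)
pQ-split (suc n) = trans (*-cong (pQ-split n) (+-congˡ (-‿cong (*-congˡ (pow-⊗ q q n)))))
  (solve 4 (λ a b q x → a :* b :* (:1 :+ :- (q :* q :* (x :* x)))
                     := a :* (:1 :+ :- (q :* x)) :* (b :* (:1 :+ :- (:- q :* x))))
    refl (poc q q n) (poc (⊖ q) q n) q (pow q n))

pQ∞r∞≈pp∞ : pQ∞ ⊗ r∞ ≈ pp∞
pQ∞r∞≈pp∞ = begin
  pQ∞ ⊗ r∞            ≈⟨ *-congʳ (⇝-unique pQ-split pQ⇝ (⇝-* pp⇝ pm⇝)) ⟩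
  pp∞ ⊗ pm∞ ⊗ r∞      ≈⟨ *-assoc _ _ _ ⟩
  pp∞ ⊗ (pm∞ ⊗ r∞)    ≈⟨ *-congˡ (recip-inverse {pm∞} ≡.refl) ⟩
  pp∞ ⊗ 𝟏             ≈⟨ *-identityʳ pp∞ ⟩
  pp∞ ∎

-- `t` and `p` are the summands of T and P. `A` and `B` are the two inhomogeneous contributions that
-- arise when the recurrence of `H` is iterated; hence the index 2n + 3.
t A B p : ℕ → PowerSeries
t n = e n ⊗ (pQ n ⊗ r (n ℕ.* 2))
A n = e n ⊗ (Q ⊗ pQ n ⊗ r (3 ℕ.+ n ℕ.* 2))
B n = e n ⊗ (q ⊗ Q ⊗ r (3 ℕ.+ n ℕ.* 2))
p n = e n ⊗ r (n ℕ.* 2)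

Small-t : Small t
Small-t = Small-*ˡ _ Small-powQ

Small-A : Small A
Small-A = Small-*ˡ _ Small-powQ

Small-B : Small B
Small-B = Small-*ˡ _ Small-powQ

Small-p : Small p
Small-p = Small-*ˡ _ Small-powQ

two 1+q : PowerSeries
two = constant (+ 2)
1+q = 𝟏 ⊕ q

r-one : 1+q ⊗ r 1 ≈ 𝟏
r-one = sym (trans (sym (1/poc-zero (⊖ q) q ≡.refl)) (trans (r-even-step 0)
  (solve 2 (λ q r → r :* (:1 :+ q :* :1) := (:1 :+ q) :* r) refl q (r 1))))

-- The quadratic factor of `K` is forced. With x = q^(2n), comparing the powers x⁴, x³, x² in the
-- required identity yields its coefficients q, 1 - q² and 2 + q in turn, and the power x then fixes
-- the multiple 2(1 + q)² of A.
T-A-relation : 𝟏 ⊗ ∑∞ t ⊕ two ⊗ 1+q ⊗ 1+q ⊗ ∑∞ A ⊕ pp∞ ⊗ (two ⊕ q) ≈ constant (+ 3) ⊕ ⊖ q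
T-A-relation = trans
  (+-cong (sym (∑∞-linear 𝟏 (two ⊗ 1+q ⊗ 1+q) Small-t Small-A)) (trans (*-congʳ (sym pQ∞r∞≈pp∞)) (*-congˡ
    -- The zero products reproduce the shape of the limit of `K`, with each `e n` replaced by 0.
    (solve 1 (λ q → :2 :+ q := :2 :+ q :+ (:1 :+ :- (q :* q)) :* :0 :+ q :* :0 :* :0) refl q))))
  (trans (∑∞-telescope _ K (Small-+ (Small-*ʳ _ Small-t) (Small-*ʳ _ Small-A)) step
      (⇝-* (⇝-* pQ⇝ r-odd⇝) (⇝-+ (⇝-+ ⇝-const (⇝-* ⇝-const e⇝)) (⇝-* (⇝-* ⇝-const e⇝) e⇝))))
    initial)
  where
  K : ℕ → PowerSeries
  K n = pQ n ⊗ r (1 ℕ.+ n ℕ.* 2) ⊗ (two ⊕ q ⊕ (𝟏 ⊕ ⊖ Q) ⊗ e n ⊕ q ⊗ e n ⊗ e n)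
  step : ∀ n → 𝟏 ⊗ t n ⊕ two ⊗ 1+q ⊗ 1+q ⊗ A n ⊕ K (suc n) ≈ K n
  step n = trans
    (+-congʳ (+-congʳ (*-congˡ (*-congˡ (*-congˡ (trans (r-even-step n) (*-congʳ r₁)))))))
    (trans
      (solve 4 (λ q x p r →
          :1 :* (x :* (p :* (r :* (:1 :+ q :* (q :* q :* x)) :* (:1 :+ q :* q :* x) :* (:1 :+ q :* x))))
          :+ :2 :* (:1 :+ q) :* (:1 :+ q) :* (x :* (q :* q :* p :* r))
          :+ p :* (:1 :+ :- (q :* q :* x)) :* r
             :* (:2 :+ q :+ (:1 :+ :- (q :* q)) :* (q :* q :* x) :+ q :* (q :* q :* x) :* (q :* q :* x))
          := p :* (r :* (:1 :+ q :* (q :* q :* x)) :* (:1 :+ q :* q :* x))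
             :* (:2 :+ q :+ (:1 :+ :- (q :* q)) :* x :+ q :* x :* x))
        refl q (e n) (pQ n) (r (3 ℕ.+ n ℕ.* 2)))
      (*-congʳ (*-congˡ (sym r₁))))
    where
    r₁ : r (1 ℕ.+ n ℕ.* 2) ≈ r (3 ℕ.+ n ℕ.* 2) ⊗ (𝟏 ⊕ q ⊗ (Q ⊗ e n)) ⊗ (𝟏 ⊕ Q ⊗ e n)
    r₁ = trans (r-odd-step n) (*-congʳ (r-even-step (suc n)))
  initial : K 0 ≈ constant (+ 3) ⊕ ⊖ q
  initial = trans
    -- At n = 0 the quadratic is (3 - q)(1 + q), and 1 + q cancels `r 1`: the source of 3 - q in the
    -- theorem.
    (solve 2 (λ q r → :1 :* r :* (:2 :+ q :+ (:1 :+ :- (q :* q)) :* :1 :+ q :* :1 :* :1)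
                   := (:3 :+ :- q) :* ((:1 :+ q) :* r)) refl q (r 1))
    (trans (*-congˡ r-one) (*-identityʳ _))

-- H k is (q²;q²)∞ times the sum of the header at z = q^(2k+2), which clears the
-- infinite product from the denominators; thus H 0 = T.
h : ℕ → ℕ → PowerSeries
h k m = e m ⊗ (pQ (m ℕ.+ k) ⊗ r (m ℕ.* 2))

H : ℕ → PowerSeries
H k = ∑∞ (h k)

Small-h : ∀ k → Small (h k)
Small-h k = Small-*ˡ _ Small-powQ

H-recurrence : ∀ k →
  (𝟏 ⊕ q ⊗ (Q ⊗ e k)) ⊗ (𝟏 ⊕ Q ⊗ e k) ⊗ H k ⊕ ⊖ 𝟏 ⊗ H (suc k) ⊕ Q ⊗ e k ⊗ (q ⊗ pp∞)
  ≈ Q ⊗ e k ⊗ (two ⊗ 1+q ⊗ pQ k)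
H-recurrence k = trans
  (+-cong (sym (∑∞-linear α (⊖ 𝟏) (Small-h k) (Small-h (suc k)))) (*-congˡ (trans (*-congˡ (sym pQ∞r∞≈pp∞))
    (solve 3 (λ q a b → q :* (a :* b) := a :* b :* (q :+ :0) :* (:1 :+ :0)) refl q pQ∞ r∞))))
  (trans (∑∞-telescope _ K (Small-+ (Small-*ʳ _ (Small-h k)) (Small-*ʳ _ (Small-h (suc k)))) step
      (⇝-* ⇝-const (⇝-* (⇝-* (⇝-* (⇝-subseq _ (λ m → ℕ.m≤m+n m k) pQ⇝) r-even⇝)
        (⇝-+ ⇝-const e⇝)) (⇝-+ ⇝-const e⇝))))
    (*-congˡ (trans (*-congʳ (*-congʳ (*-congˡ (1/poc-zero (⊖ q) q ≡.refl))))
      (solve 2 (λ q p → p :* :1 :* (q :+ :1) :* (:1 :+ :1) := :2 :* (:1 :+ q) :* p)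
        refl q (pQ k)))))
  where
  α : PowerSeries
  α = (𝟏 ⊕ q ⊗ (Q ⊗ e k)) ⊗ (𝟏 ⊕ Q ⊗ e k)
  -- For m ≥ 1 the last two factors are q (1 + q^(2m-1)) (1 + q^(2m)) and turn `r (2m)` into q times
  -- `r (2m − 2)`. The uncancelled form also covers m = 0, where it gives the 2(1 + q) of the
  -- statement.
  K : ℕ → PowerSeries
  K m = Q ⊗ e k ⊗ (pQ (m ℕ.+ k) ⊗ r (m ℕ.* 2) ⊗ (q ⊕ e m) ⊗ (𝟏 ⊕ e m))
  step : ∀ m → α ⊗ h k m ⊕ ⊖ 𝟏 ⊗ h (suc k) m ⊕ K (suc m) ≈ K m
  step m = trans
    (+-cong
      (+-cong (*-congˡ (*-congˡ (*-congˡ r₀)))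
              (*-congˡ (*-congˡ (*-cong (trans (reflexive (≡.cong pQ (ℕ.+-suc m k))) p₁) r₀))))
      (*-congˡ (*-congʳ (*-congʳ (*-congʳ p₁)))))
    (trans
      (solve 5 (λ q x y p r →
          let Q  = q :* q
              r₀ = r :* (:1 :+ Q :* x) :* (:1 :+ q :* x)
              p₁ = p :* (:1 :+ :- (Q :* (x :* y)))
          in  (:1 :+ q :* (Q :* y)) :* (:1 :+ Q :* y) :* (x :* (p :* r₀))
                :+ :- :1 :* (x :* (p₁ :* r₀))
                :+ Q :* y :* (p₁ :* r :* (q :+ Q :* x) :* (:1 :+ Q :* x))
           := Q :* y :* (p :* r₀ :* (q :+ x) :* (:1 :+ x)))
        refl q (e m) (e k) (pQ (m ℕ.+ k)) (r (2 ℕ.+ m ℕ.* 2)))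
      (*-congˡ (*-congʳ (*-congʳ (*-congˡ (sym r₀))))))
    where
    r₀ : r (m ℕ.* 2) ≈ r (2 ℕ.+ m ℕ.* 2) ⊗ (𝟏 ⊕ Q ⊗ e m) ⊗ (𝟏 ⊕ q ⊗ e m)
    r₀ = trans (r-even-step m) (*-congʳ (r-odd-step m))
    p₁ : pQ (suc (m ℕ.+ k)) ≈ pQ (m ℕ.+ k) ⊗ (𝟏 ⊕ ⊖ (Q ⊗ (e m ⊗ e k)))
    p₁ = *-congˡ (+-congˡ (-‿cong (*-congˡ (pow-+ Q m k))))

-- The limit k → ∞ is z = 0, where the infinite product in z becomes 1; the normalising factor
-- (q²;q²)∞ of `H` survives.
H⇝ : H ⇝ pQ∞ ⊗ ∑∞ p
H⇝ = lim λ k → mod-trans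
  (∑∞-mod λ m → mod-trans
    (mod-* (fromEq refl) (mod-*ˡ _ (mod-weaken (ℕ.m≤n+m k m) (near pQ⇝ (m ℕ.+ k)))))
    (fromEq (solve 3 (λ x p r → x :* (p :* r) := p :* (x :* r)) refl (e m) pQ∞ (r (m ℕ.* 2)))))
  (fromEq (∑∞-scale pQ∞ Small-p))

-- The integrating factor (1 + q) r (2k + 1) = 1/(-q²;q)₂ₖ absorbs the coefficient of `H k` in the
-- recurrence. It equals 1 at k = 0, so the boundary values are T and the limit of `H` at z = 0, a
-- multiple of P.
T-A-B-P-relation :
  two ⊗ 1+q ⊗ 1+q ⊗ ∑∞ A ⊕ ⊖ (pp∞ ⊗ 1+q) ⊗ ∑∞ B ⊕ 1+q ⊗ pp∞ ⊗ ∑∞ p ≈ ∑∞ t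
T-A-B-P-relation = trans
  (+-cong (sym (∑∞-linear (two ⊗ 1+q ⊗ 1+q) (⊖ (pp∞ ⊗ 1+q)) Small-A Small-B))
    (trans (*-congʳ (*-congˡ (sym pQ∞r∞≈pp∞)))
      (solve 4 (λ a b c d → a :* (b :* c) :* d := a :* c :* (b :* d)) refl 1+q pQ∞ r∞ (∑∞ p))))
  (trans (∑∞-telescope _ K (Small-+ (Small-*ʳ _ Small-A) (Small-*ʳ _ Small-B)) step
      (⇝-* (⇝-* ⇝-const r-odd⇝) H⇝))
    (trans (*-congʳ r-one) (trans (*-identityˡ (H 0)) (∑∞-cong λ m →
      reflexive (≡.cong (λ n → e m ⊗ (pQ n ⊗ r (m ℕ.* 2))) (ℕ.+-identityʳ m))))))
  where
  K : ℕ → PowerSeries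
  K k = 1+q ⊗ r (1 ℕ.+ k ℕ.* 2) ⊗ H k
  step : ∀ k → two ⊗ 1+q ⊗ 1+q ⊗ A k ⊕ ⊖ (pp∞ ⊗ 1+q) ⊗ B k ⊕ K (suc k) ≈ K k
  step k = trans
    (solve 6 (λ q y p r c H₁ →
        :2 :* (:1 :+ q) :* (:1 :+ q) :* (y :* (q :* q :* p :* r))
          :+ :- (c :* (:1 :+ q)) :* (y :* (q :* (q :* q) :* r)) :+ (:1 :+ q) :* r :* H₁
        := (:1 :+ q) :* r :* (q :* q :* y :* (:2 :* (:1 :+ q) :* p)
             :+ H₁ :+ :- (q :* q :* y :* (q :* c))))
      refl q (e k) (pQ k) (r (3 ℕ.+ k ℕ.* 2)) pp∞ (H (suc k)))
    (trans (*-congˡ (+-congʳ (+-congʳ (sym (H-recurrence k)))))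
      (trans
        (solve 7 (λ a b r H₀ H₁ z w →
            z :* r :* (a :* b :* H₀ :+ :- :1 :* H₁ :+ w :+ H₁ :+ :- w) := z :* (r :* a :* b) :* H₀)
          refl (𝟏 ⊕ q ⊗ (Q ⊗ e k)) (𝟏 ⊕ Q ⊗ e k) (r (3 ℕ.+ k ℕ.* 2)) (H k) (H (suc k)) 1+q
          (Q ⊗ e k ⊗ (q ⊗ pp∞)))
        (*-congʳ (*-congˡ (sym (trans (r-odd-step k) (*-congʳ (r-even-step (suc k)))))))))

-- For N ≥ 1, q^N r N = r (N - 1) - r N, so the sum of all q^N / (-q;q)_N telescopes; P collects the
-- even N and B the odd N from 3 on.
P-B-relation : ∑∞ p ⊕ ∑∞ B ⊕ r∞ ≈ 𝟏 ⊕ r 1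
P-B-relation = trans
  (+-cong (trans (solve 2 (λ a b → a :+ b := :1 :* a :+ :1 :* b) refl (∑∞ p) (∑∞ B))
                 (sym (∑∞-linear 𝟏 𝟏 Small-p Small-B)))
          (solve 1 (λ r → r := :0 :* r :+ r) refl r∞))
  (trans (∑∞-telescope _ K (Small-+ (Small-*ʳ _ Small-p) (Small-*ʳ _ Small-B)) step
      (⇝-+ (⇝-* e⇝ r-even⇝) r-odd⇝))
    (+-congʳ (trans (*-identityˡ _) (1/poc-zero (⊖ q) q ≡.refl))))
  where
  K : ℕ → PowerSeries
  K n = e n ⊗ r (n ℕ.* 2) ⊕ r (1 ℕ.+ n ℕ.* 2)
  step : ∀ n → 𝟏 ⊗ p n ⊕ 𝟏 ⊗ B n ⊕ K (suc n) ≈ K n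
  step n = trans
    (+-congˡ (+-congʳ (*-congˡ r₂)))
    (trans
      (solve 4 (λ q x r₀ r → let r₂ = r :* (:1 :+ q :* (q :* q :* x)) in
          :1 :* (x :* r₀) :+ :1 :* (x :* (q :* (q :* q) :* r)) :+ (q :* q :* x :* r₂ :+ r)
          := x :* r₀ :+ r₂ :* (:1 :+ q :* q :* x))
        refl q (e n) (r (n ℕ.* 2)) (r (3 ℕ.+ n ℕ.* 2)))
      (+-congˡ (trans (*-congʳ (sym r₂)) (sym (r-odd-step n)))))
    where
    r₂ : r (2 ℕ.+ n ℕ.* 2) ≈ r (3 ℕ.+ n ℕ.* 2) ⊗ (𝟏 ⊕ q ⊗ (Q ⊗ e n))
    r₂ = r-even-step (suc n)

-- Iteration from P to φ₃(-q) and a theta series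

j : ℕ → ℕ → PowerSeries
j n m = e m ⊗ (o m ⊗ s (m ℕ.+ n))

J : ℕ → PowerSeries
J n = ∑∞ (j n)

Small-j : ∀ n → Small (j n)
Small-j n = Small-*ˡ _ Small-powQ

s-step : ∀ n → s n ≈ s (suc n) ⊗ (𝟏 ⊕ Q ⊗ e n)
s-step n = trans (1/poc-step (⊖ Q) Q n ≡.refl) (*-congˡ (+-congˡ
  (solve 2 (λ q x → :- (:- q :* x) := q :* x) refl Q (e n))))

o-step : ∀ n → o n ≈ o (suc n) ⊗ (𝟏 ⊕ q ⊗ e n)
o-step n = trans (1/poc-step (⊖ q) Q n ≡.refl) (*-congˡ (+-congˡ
  (solve 2 (λ q x → :- (:- q :* x) := q :* x) refl q (e n))))

os≈r : ∀ n → o n ⊗ s n ≈ r (n ℕ.* 2)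
os≈r n = inverse-unique
  (trans (*-congʳ (split n))
    (trans (solve 4 (λ a b c d → a :* b :* (c :* d) := a :* c :* (b :* d)) refl
             (poc (⊖ q) Q n) (poc (⊖ Q) Q n) (o n) (s n))
      (trans (*-cong (1/poc-inverse (⊖ q) Q n ≡.refl) (1/poc-inverse (⊖ Q) Q n ≡.refl)) (*-identityˡ 𝟏))))
  (1/poc-inverse (⊖ q) q (n ℕ.* 2) ≡.refl)
  where
  split : ∀ n → poc (⊖ q) q (n ℕ.* 2) ≈ poc (⊖ q) Q n ⊗ poc (⊖ Q) Q n
  split zero    = sym (*-identityˡ 𝟏)
  split (suc n) = trans
    (*-cong (*-cong (split n) (+-congˡ (-‿cong (*-congˡ (pow-double n)))))
            (+-congˡ (-‿cong (*-congˡ (*-congˡ (pow-double n))))))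
    (solve 4 (λ a b q x → a :* b :* (:1 :+ :- (:- q :* x)) :* (:1 :+ :- (:- q :* (q :* x)))
                       := a :* (:1 :+ :- (:- q :* x)) :* (b :* (:1 :+ :- (:- (q :* q) :* x))))
      refl (poc (⊖ q) Q n) (poc (⊖ Q) Q n) q (e n))

o∞s∞≈r∞ : o∞ ⊗ s∞ ≈ r∞
o∞s∞≈r∞ = ⇝-unique os≈r (⇝-* o⇝ s⇝) r-even⇝

J-recurrence : ∀ n → 𝟏 ⊗ J n ⊕ q ⊗ Q ⊗ e n ⊗ J (suc n) ⊕ q ⊗ r∞ ≈ 1+q ⊗ s n
J-recurrence n = trans
  (+-cong (sym (∑∞-linear 𝟏 (q ⊗ Q ⊗ e n) (Small-j n) (Small-j (suc n))))
    (trans (*-congˡ (sym o∞s∞≈r∞))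
      (solve 3 (λ q a b → q :* (a :* b) := b :* a :* (q :+ :0)) refl q o∞ s∞)))
  (trans (∑∞-telescope _ K (Small-+ (Small-*ʳ _ (Small-j n)) (Small-*ʳ _ (Small-j (suc n)))) step
      (⇝-* (⇝-* (⇝-subseq _ (λ m → ℕ.m≤m+n m n) s⇝) o⇝) (⇝-+ ⇝-const e⇝)))
    (trans (*-congʳ (*-congˡ (1/poc-zero (⊖ q) Q ≡.refl)))
      (solve 2 (λ q s → s :* :1 :* (q :+ :1) := (:1 :+ q) :* s) refl q (s n))))
  where
  -- For m ≥ 1, q + q^(2m) is q times the last factor of (-q;q²)ₘ, so `K` is again a product ratio
  -- with one index shifted.
  K : ℕ → PowerSeries
  K m = s (m ℕ.+ n) ⊗ o m ⊗ (q ⊕ e m)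
  step : ∀ m → 𝟏 ⊗ j n m ⊕ q ⊗ Q ⊗ e n ⊗ j (suc n) m ⊕ K (suc m) ≈ K m
  step m = trans
    (+-cong
      (+-cong (*-congˡ (*-congˡ (*-cong (o-step m) s₀)))
              (*-congˡ (*-congˡ (*-cong (o-step m) (reflexive (≡.cong s (ℕ.+-suc m n)))))))
      refl)
    (trans
      (solve 5 (λ q x y s o →
          let Q = q :* q
              s₀ = s :* (:1 :+ Q :* (x :* y))
              o₀ = o :* (:1 :+ q :* x)
          in :1 :* (x :* (o₀ :* s₀)) :+ q :* Q :* y :* (x :* (o₀ :* s)) :+ s :* o :* (q :+ Q :* x)
             := s₀ :* o₀ :* (q :+ x))
        refl q (e m) (e n) (s (suc (m ℕ.+ n))) (o (suc m)))
      (*-congʳ (*-cong (sym s₀) (sym (o-step m)))))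
    where
    s₀ : s (m ℕ.+ n) ≈ s (suc (m ℕ.+ n)) ⊗ (𝟏 ⊕ Q ⊗ (e m ⊗ e n))
    s₀ = trans (s-step (m ℕ.+ n)) (*-congˡ (+-congˡ (*-congˡ (pow-+ Q m n))))

-- f n = (−1)ⁿ q^(n²) and g n = (−1)ⁿ q^(n²+2n)
f g : ℕ → PowerSeries
f zero    = 𝟏
f (suc n) = ⊖ (q ⊗ e n) ⊗ f n
g n = e n ⊗ f n

Small-f : Small f
Small-f zero    = mkₙ λ _ ()
Small-f (suc n) = mod-trans
  (fromEq (solve 3 (λ q x y → :- (q :* x) :* y := q :* x :* :- y) refl q (e n) (f n)))
  (zero-*ˡ (⊖ f n) (q⊗-mod (Small-powQ n)))

Small-g : Small g
Small-g = Small-*ˡ _ Small-powQ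

-- Since g (n+1) = -q^(2n+3) g n, multiplying the recurrence of `J` by `g n` makes it telescope. The
-- boundary term g n J n tends to 0, and J 0 is P.
P-expansion : 1+q ⊗ ∑∞ (λ n → g n ⊗ s n) ⊕ ⊖ (q ⊗ r∞) ⊗ ∑∞ g ≈ ∑∞ p
P-expansion = trans
  (trans (sym (∑∞-linear 1+q (⊖ (q ⊗ r∞)) (Small-*ˡ _ Small-g) Small-g)) (sym (+-identityʳ _)))
  (trans (∑∞-telescope _ K (Small-+ (Small-*ʳ _ (Small-*ˡ _ Small-g)) (Small-*ʳ _ Small-g)) step
      (lim (Small-*ˡ J Small-g)))
    (trans (solve 1 (λ x → :1 :* :1 :* x := x) refl (J 0))
      (∑∞-cong λ m → *-congˡ (trans (*-congˡ (reflexive (≡.cong s (ℕ.+-identityʳ m)))) (os≈r m)))))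
  where
  K : ℕ → PowerSeries
  K n = g n ⊗ J n
  step : ∀ n → 1+q ⊗ (g n ⊗ s n) ⊕ ⊖ (q ⊗ r∞) ⊗ g n ⊕ K (suc n) ≈ K n
  step n = trans
    (solve 7 (λ q x f s r J₁ z →
        z :* (x :* f :* s) :+ :- (q :* r) :* (x :* f) :+ q :* q :* x :* (:- (q :* x) :* f) :* J₁
        := x :* f :* (z :* s :+ :- (q :* r) :+ :- (q :* (q :* q) :* x :* J₁)))
      refl q (e n) (f n) (s n) r∞ (J (suc n)) 1+q)
    (*-congˡ (trans (+-congʳ (+-congʳ (sym (J-recurrence n))))
      (solve 3 (λ J₀ v w → :1 :* J₀ :+ v :+ w :+ :- w :+ :- v := J₀)
        refl (J n) (q ⊗ Q ⊗ e n ⊗ J (suc n)) (q ⊗ r∞))))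

-- This is φ₃(-q): (-1)ⁿ q^(n²) equals (-q)^(n²), and the denominators are even in q.
φ : PowerSeries
φ = ∑∞ λ n → f n ⊗ s n

-- Trades the weights q^(n²+2n) left by the iteration for the q^(n²) of φ₃. As q e n f n = -f (n+1),
-- and (1 + e n) s n = s (n-1) for n ≥ 1, the n-th terms combine to f n s (n-1) - f (n+1) s n. The
-- right side is 1 + e n at n = 0.
φ-contiguous : 1+q ⊗ ∑∞ (λ n → g n ⊗ s n) ⊕ φ ≈ two
φ-contiguous = trans
  (trans (+-congˡ (sym (*-identityˡ φ)))
    (trans (sym (∑∞-linear 1+q 𝟏 (Small-*ˡ _ Small-g) (Small-*ˡ _ Small-f))) (sym (+-identityʳ _))))
  (trans (∑∞-telescope _ K (Small-+ (Small-*ʳ _ (Small-*ˡ _ Small-g)) (Small-*ʳ _ (Small-*ˡ _ Small-f))) step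
      (lim (Small-*ˡ _ (Small-*ˡ _ Small-f))))
    (trans (*-congˡ (1/poc-zero (⊖ Q) Q ≡.refl))
      (solve 0 (:1 :* (:1 :+ :1) :* :1 := :2) refl)))
  where
  K : ℕ → PowerSeries
  K n = f n ⊗ (𝟏 ⊕ e n) ⊗ s n
  step : ∀ n → 1+q ⊗ (g n ⊗ s n) ⊕ 𝟏 ⊗ (f n ⊗ s n) ⊕ K (suc n) ≈ K n
  step n = trans
    (+-congʳ (+-cong (*-congˡ (*-congˡ (s-step n))) (*-congˡ (*-congˡ (s-step n)))))
    (trans
      (solve 4 (λ q x f s → let s₀ = s :* (:1 :+ q :* q :* x) in
          (:1 :+ q) :* (x :* f :* s₀) :+ :1 :* (f :* s₀)
            :+ :- (q :* x) :* f :* (:1 :+ q :* q :* x) :* s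
          := f :* (:1 :+ x) :* s₀)
        refl q (e n) (f n) (s (suc n)))
      (*-congˡ (sym (s-step n))))

-- Gauss's identity for ∑ (−1)ⁿ q^(n²), by Shanks's finite form

v D : ℕ → ℕ → PowerSeries
v n k = pow (⊖ pow q (suc n)) k ⊗ (poc (⊖ 𝟏) q k ⊗ 1/poc q q k)
D n k = poc q q n ⊗ r n ⊗ v n k

r-step : ∀ n → r n ≈ r (suc n) ⊗ (𝟏 ⊕ q ⊗ pow q n)
r-step n = trans (1/poc-step (⊖ q) q n ≡.refl) (*-congˡ (+-congˡ
  (solve 2 (λ q x → :- (:- q :* x) := q :* x) refl q (pow q n))))

v-suc : ∀ n k → v (suc n) k ≈ v n k ⊗ pow q k
v-suc n k = trans
  (*-congʳ (trans (pow-cong k (solve 2 (λ q z → :- (q :* z) := :- z :* q) refl q (pow q (suc n))))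
    (pow-⊗ (⊖ pow q (suc n)) q k)))
  (solve 3 (λ a b c → a :* b :* c := a :* c :* b) refl
    (pow (⊖ pow q (suc n)) k) (pow q k) (poc (⊖ 𝟏) q k ⊗ 1/poc q q k))

f≈pow : ∀ n → f n ≈ pow (⊖ pow q n) n
f≈pow zero    = refl
f≈pow (suc n) = trans (*-cong (-‿cong (*-congˡ (pow-⊗ q q n))) (f≈pow n))
  (trans (solve 3 (λ q x y → :- (q :* (x :* x)) :* y := :- (q :* x) :* (y :* x))
           refl q (pow q n) (pow (⊖ pow q n) n))
    (*-congˡ (sym (trans
      (pow-cong n (solve 2 (λ q z → :- (q :* z) := :- z :* q) refl q (pow q n)))
      (pow-⊗ (⊖ pow q n) q n)))))

poc-minus-one : ∀ n → poc (⊖ 𝟏) q (suc n) ≈ two ⊗ poc (⊖ q) q n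
poc-minus-one zero    = solve 0
  (:1 :* (:1 :+ :- (:- :1 :* :1)) := :2 :* :1) refl
poc-minus-one (suc n) = trans (*-congʳ (poc-minus-one n))
  (solve 3 (λ q x a → :2 :* a :* (:1 :+ :- (:- :1 :* (q :* x)))
                   := :2 :* (a :* (:1 :+ :- (:- q :* x)))) refl q (pow q n) (poc (⊖ q) q n))

module _ (n : ℕ) where

  private
    U : ℕ → PowerSeries
    U k = poc q q n ⊗ r (suc n) ⊗ v n k ⊗ (𝟏 ⊕ ⊖ pow q k)

  -- A pair of Wilf-Zeilberger type: a difference in n equals a difference in k. A partial row sum
  -- thus changes only by the value of `U` at its end, because the factor 1 - q^k annihilates `U 0`.
  D-step : ∀ k → D (suc n) k ⊕ U k ≈ D n k ⊕ U (suc k)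
  D-step k = trans
    (+-cong (*-congˡ (trans (v-suc n k) (*-congʳ v₀))) (*-congʳ (*-congˡ v₀)))
    (trans
      (solve 7 (λ q x y a r v m →
          let v₀ = v :* (m :* (:1 :+ :- (q :* y)))
              z  = :1 :+ :- (q :* x)
          in a :* z :* r :* (v₀ :* y) :+ a :* r :* v₀ :* (:1 :+ :- y)
             := a :* (r :* (:1 :+ q :* x)) :* v₀
                :+ a :* r :* (:- (q :* x) :* v :* (m :* (:1 :+ :- (:- :1 :* y))))
                   :* (:1 :+ :- (q :* y)))
        refl q (pow q n) (pow q k) (poc q q n) (r (suc n)) (pow (⊖ pow q (suc n)) k)
        (poc (⊖ 𝟏) q k ⊗ 1/poc q q (suc k)))
      (+-cong (*-cong (*-congˡ (sym (r-step n))) (sym v₀))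
        (*-congʳ (*-congˡ (*-congˡ (solve 3 (λ a b c → a :* b :* c := a :* c :* b) refl
          (poc (⊖ 𝟏) q k) (1/poc q q (suc k)) (𝟏 ⊕ ⊖ (⊖ 𝟏 ⊗ pow q k))))))))
    where
    v₀ : v n k ≈ pow (⊖ pow q (suc n)) k ⊗ (poc (⊖ 𝟏) q k ⊗ 1/poc q q (suc k) ⊗ (𝟏 ⊕ ⊖ (q ⊗ pow q k)))
    v₀ = *-congˡ (trans (*-congˡ (1/poc-step q q k ≡.refl)) (sym (*-assoc _ _ _)))

  D-row : ∀ N → partialSum (D (suc n)) N ≈ partialSum (D n) N ⊕ U N
  D-row zero    = sym (trans (+-identityˡ _) (solve 1 (λ a → a :* (:1 :+ :- :1) := :0)
    refl (poc q q n ⊗ r (suc n) ⊗ v n 0)))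
  D-row (suc N) = trans (+-congʳ (D-row N)) (trans
    (solve 3 (λ a b c → a :+ b :+ c := a :+ (c :+ b)) refl (partialSum (D n) N) (U N) (D (suc n) N))
    (trans (+-congˡ (D-step N)) (sym (solve 3 (λ a b c → a :+ b :+ c := a :+ (b :+ c))
      refl (partialSum (D n) N) (D n N) (U (suc N))))))

  -- The end term of the row and the new diagonal entry together supply the theta terms of index n +
  -- 1 and -(n + 1). Their 2 comes from (-1;q)ₙ₊₁ = 2(-q;q)ₙ.
  D-diagonal : U (suc n) ⊕ D (suc n) (suc n) ≈ two ⊗ f (suc n)
  D-diagonal = trans
    (+-cong (*-congʳ (*-congˡ v₁)) (*-congˡ (trans (v-suc n (suc n)) (*-congʳ v₁))))
    (trans
      (solve 7 (λ q x a r F m c →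
          let v₁ = F :* (:2 :* m :* c)
              z  = :1 :+ :- (q :* x)
          in a :* r :* v₁ :* z :+ a :* z :* r :* (v₁ :* (q :* x))
             := (a :* z :* c) :* (m :* (r :* (:1 :+ q :* x))) :* (:2 :* F))
        refl q (pow q n) (poc q q n) (r (suc n)) (pow (⊖ pow q (suc n)) (suc n))
        (poc (⊖ q) q n) (1/poc q q (suc n)))
      (trans (*-cong (*-cong (1/poc-inverse q q (suc n) ≡.refl)
          (trans (*-congˡ (sym (r-step n))) (1/poc-inverse (⊖ q) q n ≡.refl)))
          (*-congˡ (sym (f≈pow (suc n)))))
        (solve 1 (λ x → :1 :* :1 :* x := x) refl (two ⊗ f (suc n)))))
    where
    v₁ : v n (suc n) ≈ pow (⊖ pow q (suc n)) (suc n) ⊗ (two ⊗ poc (⊖ q) q n ⊗ 1/poc q q (suc n))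
    v₁ = *-congˡ (*-congʳ (poc-minus-one n))

shanks : ∀ n → 𝟏 ⊕ two ⊗ partialSum (f ∘ suc) n ≈ partialSum (D n) (suc n)
shanks zero    = sym (trans
  (+-congˡ (*-cong (*-congˡ (1/poc-zero (⊖ q) q ≡.refl)) (*-congˡ (*-congˡ (1/poc-zero q q ≡.refl)))))
  (solve 0 (:0 :+ :1 :* :1 :* (:1 :* (:1 :* :1))
            := :1 :+ :2 :* :0) refl))
shanks (suc n) = trans
  (solve 2 (λ a b → :1 :+ :2 :* (a :+ b) := :1 :+ :2 :* a :+ :2 :* b)
    refl (partialSum (f ∘ suc) n) (f (suc n)))
  (trans (+-cong (shanks n) (sym (D-diagonal n)))
    (trans (sym (+-assoc _ _ _)) (+-congʳ (sym (D-row n (suc n))))))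

-- Here -q g n = f (n+1), so the left side is the bilateral theta series. In the finite form `D n k`
-- carries the factor q^((n+1)k), so only the column k = 0 survives as n grows.
gauss : 𝟏 ⊕ ⊖ (two ⊗ q) ⊗ ∑∞ g ≈ pp∞ ⊗ r∞
gauss = ⇝-unique
  (λ n → trans (+-congˡ (trans
      (solve 2 (λ q x → :- (:2 :* q) :* x := :2 :* (:- q :* x :+ :0 :* x)) refl q (partialSum g n))
      (*-congˡ (trans (sym (partialSum-linear (⊖ q) 𝟎 g g n)) (partialSum-cong n λ k →
        solve 3 (λ q x y → :- q :* (x :* y) :+ :0 :* (x :* y) := :- (q :* x) :* y) refl q (e k) (f k))))))
    (shanks n))
  (⇝-+ ⇝-const (⇝-* ⇝-const (partialSum⇝∑∞ Small-g)))
  (lim λ n → mod-trans (first-column n n) (near (⇝-* pp⇝ r⇝) n))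
  where
  first-column : ∀ n N → partialSum (D n) (suc N) ≈[ n ] poc q q n ⊗ r n
  first-column n zero    = fromEq (trans (+-congˡ (*-congˡ (*-congˡ (*-congˡ (1/poc-zero q q ≡.refl)))))
    (solve 1 (λ a → :0 :+ a :* (:1 :* (:1 :* :1)) := a) refl (poc q q n ⊗ r n)))
  first-column n (suc N) = mod-trans (mod-+ (first-column n N) column-small) (fromEq (+-identityʳ _))
    where
    column-small : D n (suc N) ≈[ n ] 𝟎
    column-small = mod-trans (fromEq
      (solve 5 (λ a q x y m → a :* (:- (q :* x) :* y :* m) := x :* (:- (a :* q :* y :* m)))
        refl (poc q q n ⊗ r n) q (pow q n) (pow (⊖ pow q (suc n)) N)
        (poc (⊖ 𝟏) q (suc N) ⊗ 1/poc q q (suc N))))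
      (zero-*ˡ _ (Small-pow n))

-- Elimination of the auxiliary series

difference : ∀ {x y} → x ≈ y → x ⊕ ⊖ y ≈ 𝟎
difference {x} {y} x≈y = trans (+-congʳ x≈y) (solve 1 (λ y → y :+ :- y := :0) refl y)

T-closed-form : two ⊗ ∑∞ t ≈
  constant (+ 3) ⊕ ⊖ q ⊕ two ⊗ q ⊗ pp∞ ⊕ ⊖ (two ⊗ 1+q ⊗ pp∞ ⊗ φ) ⊕ 1+q ⊗ pp∞ ⊗ pp∞ ⊗ r∞ ⊗ r∞
T-closed-form = trans
  -- Each dᵢ vanishes by a relation proved above. d₁ - d₂ cancels A and doubles T; d₃ removes B and
  -- doubles P; d₄ evaluates `r 1`; d₅ and d₆ exchange P for φ through Γ; d₇ replaces the theta sum
  -- G.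
  (solve 11 (λ q c r r₁ T A B P φ Γ G →
      let two = :2
          z   = :1 :+ q
          d₁  = :1 :* T :+ two :* z :* z :* A :+ c :* (two :+ q) :+ :- (:3 :+ :- q)
          d₂  = two :* z :* z :* A :+ :- (c :* z) :* B :+ z :* c :* P :+ :- T
          d₃  = P :+ B :+ r :+ :- (:1 :+ r₁)
          d₄  = z :* r₁ :+ :- :1
          d₅  = z :* Γ :+ :- (q :* r) :* G :+ :- P
          d₆  = z :* Γ :+ φ :+ :- two
          d₇  = :1 :+ :- (two :* q) :* G :+ :- (c :* r)
      in two :* T
         := :3 :+ :- q :+ two :* q :* c :+ :- (two :* z :* c :* φ) :+ z :* c :* c :* r :* r
            :+ (d₁ :+ :- d₂ :+ :- (c :* z) :* d₃ :+ :- c :* d₄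
                :+ :- (two :* c :* z) :* d₅ :+ two :* c :* z :* d₆ :+ c :* z :* r :* d₇))
    refl q pp∞ r∞ (r 1) (∑∞ t) (∑∞ A) (∑∞ B) (∑∞ p) φ (∑∞ λ n → g n ⊗ s n) (∑∞ g))
  (trans
    (+-congˡ (+-cong (+-cong (+-cong (+-cong (+-cong (+-cong
      (difference T-A-relation)
      (-‿cong (difference T-A-B-P-relation)))
      (*-congˡ (difference P-B-relation)))
      (*-congˡ (difference r-one)))
      (*-congˡ (difference P-expansion)))
      (*-congˡ (difference φ-contiguous)))
      (*-congˡ (difference gauss))))
    (solve 4 (λ u c z r → let O = :0 in
        u :+ (O :+ :- O :+ :- (c :* z) :* O :+ :- c :* O
              :+ :- (:2 :* c :* z) :* O :+ :2 :* c :* z :* O :+ c :* z :* r :* O) := u)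
      refl _ pp∞ 1+q r∞))

-- Return to the partition generating function and the stated right-hand side

1/pp∞ : PowerSeries
1/pp∞ = recip pp∞

pp∞-inverse : pp∞ ⊗ 1/pp∞ ≈ 𝟏
pp∞-inverse = recip-inverse {pp∞} ≡.refl

-- Completing the two products to (q;q)∞ and (q²;q²)₂ₘ = (q;q)₂ₘ (-q;q)₂ₘ, the factor (q;q)₂ₘ
-- cancels. The denominator becomes (q;q)∞ (-q;q)₂ₘ / (q²;q²)ₘ.
G′-term : ∀ m →
  ⟪ qpow (1 ℕ.+ m ℕ.* 2) *ₛ inv (pochInf (+ 1) (1 ℕ.+ m ℕ.* 2) 1 *ₛ poch (+ 1) (2 ℕ.+ m ℕ.* 2) 2 m) ⟫
  ≈ q ⊗ 1/pp∞ ⊗ t m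
G′-term m = begin
  ⟪ qpow (1 ℕ.+ m ℕ.* 2) *ₛ inv (pochInf (+ 1) (1 ℕ.+ m ℕ.* 2) 1 *ₛ poch (+ 1) (2 ℕ.+ m ℕ.* 2) 2 m) ⟫
    ≈⟨ mk (λ _ → ≡.refl) ⟩
  ⟪ qpow (1 ℕ.+ m ℕ.* 2) ⟫ ⊗ recip (X ⊗ Y)
    ≈⟨ *-cong (trans (qpow≈pow (1 ℕ.+ m ℕ.* 2)) (*-congˡ (pow-double m)))
         (inverse-unique (recip-inverse {X ⊗ Y} XY₀≡1) denominator) ⟩
  q ⊗ e m ⊗ (1/pp∞ ⊗ (pQ m ⊗ r (m ℕ.* 2)))
    ≈⟨ solve 4 (λ q x i y → q :* x :* (i :* y) := q :* i :* (x :* y)) refl q (e m) 1/pp∞ _ ⟩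
  q ⊗ 1/pp∞ ⊗ t m ∎
  where
  X Y : PowerSeries
  X = ⟪ pochInf (+ 1) (1 ℕ.+ m ℕ.* 2) 1 ⟫
  Y = ⟪ poch (+ 1) (2 ℕ.+ m ℕ.* 2) 2 m ⟫
  XY₀≡1 : coeff (X ⊗ Y) 0 ≡ + 1
  XY₀≡1 = ≡.cong (+ 1 *_) (≡.trans (at (poch≈poc (+ 1) (2 ℕ.+ m ℕ.* 2) 2 m) 0)
    (coeff-poc _ (pow q 2) m ≡.refl))
  X-tail : poc q q (m ℕ.* 2) ⊗ X ≈ pp∞
  X-tail = ⇝-unique
    (λ n → sym (poc-+ q q (m ℕ.* 2) n))
    (⇝-* ⇝-const (poc⇝ (+ 1) (1 ℕ.+ m ℕ.* 2) 0 (s≤s z≤n) (*-identityˡ _) pow-1))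
    (⇝-subseq _ (λ n → ℕ.m≤n+m n (m ℕ.* 2)) pp⇝)
  Y-tail : pQ m ⊗ Y ≈ poc q q (m ℕ.* 2) ⊗ poc (⊖ q) q (m ℕ.* 2)
  Y-tail = begin
    pQ m ⊗ Y
      ≈⟨ *-congˡ (trans (poch≈poc (+ 1) (2 ℕ.+ m ℕ.* 2) 2 m) (poc-cong
           (trans (*-identityˡ _) (trans (sym (*-assoc q q _)) (*-congˡ (pow-double m)))) pow-2 m)) ⟩
    pQ m ⊗ poc (Q ⊗ e m) Q m
      ≈⟨ poc-+ Q Q m m ⟨
    pQ (m ℕ.+ m)
      ≈⟨ reflexive (≡.cong pQ (≡.trans (≡.cong (m ℕ.+_) (≡.sym (ℕ.+-identityʳ m))) (ℕ.*-comm 2 m))) ⟩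
    pQ (m ℕ.* 2)
      ≈⟨ pQ-split (m ℕ.* 2) ⟩
    poc q q (m ℕ.* 2) ⊗ poc (⊖ q) q (m ℕ.* 2) ∎
  denominator : X ⊗ Y ⊗ (1/pp∞ ⊗ (pQ m ⊗ r (m ℕ.* 2))) ≈ 𝟏
  denominator = begin
    X ⊗ Y ⊗ (1/pp∞ ⊗ (pQ m ⊗ r (m ℕ.* 2)))
      ≈⟨ solve 5 (λ x y i a r → x :* y :* (i :* (a :* r)) := a :* y :* (x :* i :* r)) refl X Y 1/pp∞ (pQ m) _ ⟩
    pQ m ⊗ Y ⊗ (X ⊗ 1/pp∞ ⊗ r (m ℕ.* 2))
      ≈⟨ *-congʳ Y-tail ⟩
    poc q q (m ℕ.* 2) ⊗ poc (⊖ q) q (m ℕ.* 2) ⊗ (X ⊗ 1/pp∞ ⊗ r (m ℕ.* 2))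
      ≈⟨ solve 5 (λ a b x i r → a :* b :* (x :* i :* r) := a :* x :* i :* (b :* r)) refl
           (poc q q (m ℕ.* 2)) (poc (⊖ q) q (m ℕ.* 2)) X 1/pp∞ (r (m ℕ.* 2)) ⟩
    poc q q (m ℕ.* 2) ⊗ X ⊗ 1/pp∞ ⊗ (poc (⊖ q) q (m ℕ.* 2) ⊗ r (m ℕ.* 2))
      ≈⟨ *-cong (trans (*-congʳ X-tail) pp∞-inverse) (1/poc-inverse (⊖ q) q (m ℕ.* 2) ≡.refl) ⟩
    𝟏 ⊗ 𝟏
      ≈⟨ *-identityˡ 𝟏 ⟩
    𝟏 ∎

G′≈ : ⟪ G'gen ⟫ ≈ q ⊗ 1/pp∞ ⊗ ∑∞ t
G′≈ = begin
  ⟪ G'gen ⟫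
    ≈⟨ mk (λ _ → ≡.refl) ⟩
  ∑∞ (λ m → ⟪ qpow (2 ℕ.* m ℕ.+ 1)
              *ₛ inv (pochInf (+ 1) (2 ℕ.* m ℕ.+ 1) 1 *ₛ poch (+ 1) (2 ℕ.* m ℕ.+ 2) 2 m) ⟫)
    ≈⟨ ∑∞-cong (λ m → trans
         (reflexive (≡.cong₂ (λ a b → ⟪ qpow a *ₛ inv (pochInf (+ 1) a 1 *ₛ poch (+ 1) b 2 m) ⟫)
           (shift m 1) (shift m 2)))
         (G′-term m)) ⟩
  ∑∞ (λ m → q ⊗ 1/pp∞ ⊗ t m)
    ≈⟨ ∑∞-scale (q ⊗ 1/pp∞) Small-t ⟩
  q ⊗ 1/pp∞ ⊗ ∑∞ t ∎
  where
  shift : ∀ m k → 2 ℕ.* m ℕ.+ k ≡ k ℕ.+ m ℕ.* 2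
  shift m k = ≡.trans (ℕ.+-comm (2 ℕ.* m) k) (≡.cong (k ℕ.+_) (ℕ.*-comm 2 m))

f≈pow-square : ∀ n → f n ≈ pow (⊖ q) (n ℕ.* n)
f≈pow-square zero    = refl
f≈pow-square (suc n) = begin
  ⊖ (q ⊗ e n) ⊗ f n
    ≈⟨ *-cong (-‿cong (*-congˡ (trans (pow-cong n (solve 1 (λ q → q :* q := :- q :* :- q) refl q))
         (pow-⊗ (⊖ q) (⊖ q) n)))) (f≈pow-square n) ⟩
  ⊖ (q ⊗ (pow (⊖ q) n ⊗ pow (⊖ q) n)) ⊗ pow (⊖ q) (n ℕ.* n)
    ≈⟨ solve 3 (λ q x y → :- (q :* (x :* x)) :* y := :- q :* (x :* (x :* y))) refl q _ _ ⟩
  ⊖ q ⊗ (pow (⊖ q) n ⊗ (pow (⊖ q) n ⊗ pow (⊖ q) (n ℕ.* n)))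
    ≈⟨ *-congˡ (trans (pow-+ (⊖ q) n (n ℕ.+ n ℕ.* n)) (*-congˡ (pow-+ (⊖ q) n (n ℕ.* n)))) ⟨
  ⊖ q ⊗ pow (⊖ q) (n ℕ.+ (n ℕ.+ n ℕ.* n))
    ≈⟨ *-congˡ (reflexive (≡.cong (λ k → pow (⊖ q) (n ℕ.+ k)) (≡.sym (ℕ.*-suc n n)))) ⟩
  pow (⊖ q) (suc n ℕ.* suc n) ∎

σ-Q : σ Q ≈ Q
σ-Q = trans (σ-⊗ q q) (trans (*-cong σ-q σ-q) (solve 1 (λ q → :- q :* :- q := q :* q) refl q))

φ₃≈ : ⟪ negq phi3 ⟫ ≈ φ
φ₃≈ = begin
  ⟪ negq phi3 ⟫
    ≈⟨ mk (negq≡ phi3) ⟩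
  σ (∑∞ λ n → ⟪ qpow (n ℕ.* n) ⟫ ⊗ recip (P n))
    ≈⟨ σ-∑∞ _ ⟩
  ∑∞ (λ n → σ (⟪ qpow (n ℕ.* n) ⟫ ⊗ recip (P n)))
    ≈⟨ ∑∞-cong (λ n → trans (σ-⊗ _ _) (*-cong (numerator n) (denominator n))) ⟩
  φ ∎
  where
  P : ℕ → PowerSeries
  P n = ⟪ poch (ℤ.- + 1) 2 2 n ⟫
  P≈ : ∀ n → P n ≈ poc (⊖ Q) Q n
  P≈ n = trans (poch≈poc (ℤ.- + 1) 2 2 n) (poc-cong (trans (minus-one _) (-‿cong pow-2)) pow-2 n)
  numerator : ∀ n → σ ⟪ qpow (n ℕ.* n) ⟫ ≈ f n
  numerator n = trans (σ-cong (qpow≈pow (n ℕ.* n))) (trans (σ-pow q (n ℕ.* n))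
    (trans (pow-cong (n ℕ.* n) σ-q) (sym (f≈pow-square n))))
  denominator : ∀ n → σ (recip (P n)) ≈ s n
  denominator n = inverse-unique
    (begin
      poc (⊖ Q) Q n ⊗ σ (recip (P n))
        ≈⟨ *-congʳ (trans (σ-poc (⊖ Q) Q n) (poc-cong (trans (σ-⊖ Q) (-‿cong σ-Q)) σ-Q n)) ⟨
      σ (poc (⊖ Q) Q n) ⊗ σ (recip (P n))
        ≈⟨ σ-⊗ _ _ ⟨
      σ (poc (⊖ Q) Q n ⊗ recip (P n))
        ≈⟨ σ-cong (trans (*-congʳ (sym (P≈ n)))
             (recip-inverse {P n} (≡.trans (at (P≈ n) 0) (coeff-poc (⊖ Q) Q n ≡.refl)))) ⟩
      σ 𝟏
        ≈⟨ σ-𝟏 ⟩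
      𝟏 ∎)
    (1/poc-inverse (⊖ Q) Q n ≡.refl)

twiceRHS≈ : ⟪ twiceRHS ⟫ ≈
  two ⊗ Q ⊕ ⊖ (two ⊗ (q ⊕ Q) ⊗ φ) ⊕ (constant (+ 3) ⊗ q ⊕ ⊖ Q) ⊗ 1/pp∞ ⊕ (q ⊕ Q) ⊗ pQ∞ ⊗ (r∞ ⊗ r∞ ⊗ r∞)
twiceRHS≈ = begin
  ⟪ twiceRHS ⟫
    ≈⟨ mk (λ _ → ≡.refl) ⟩
  ⟪ (+ 2) ·ₛ qpow 2 ⟫ ⊕ ⊖ (⟪ (+ 2) ·ₛ (qpow 1 +ₛ qpow 2) ⟫ ⊗ ⟪ negq phi3 ⟫)
    ⊕ (⟪ (+ 3) ·ₛ qpow 1 ⟫ ⊕ ⊖ ⟪ qpow 2 ⟫) ⊗ 1/pp∞ ⊕ ⟪ qpow 1 +ₛ qpow 2 ⟫ ⊗ pQ∞ ⊗ recip (pm∞ ⊗ pm∞ ⊗ pm∞)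
    ≈⟨ +-cong (+-cong (+-cong
         (trans (scale (+ 2) (qpow 2)) (*-congˡ Q≈))
         (-‿cong (*-cong (trans (scale (+ 2) _) (*-congˡ q+Q≈)) φ₃≈)))
         (*-congʳ (+-cong (scale (+ 3) (qpow 1)) (-‿cong Q≈))))
         (*-cong (*-congʳ q+Q≈) cube) ⟩
  two ⊗ Q ⊕ ⊖ (two ⊗ (q ⊕ Q) ⊗ φ) ⊕ (constant (+ 3) ⊗ q ⊕ ⊖ Q) ⊗ 1/pp∞ ⊕ (q ⊕ Q) ⊗ pQ∞ ⊗ (r∞ ⊗ r∞ ⊗ r∞) ∎
  where
  scale : ∀ c u → ⟪ c ·ₛ u ⟫ ≈ constant c ⊗ ⟪ u ⟫
  scale c u = mk λ n → ≡.sym (const-* c u n)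
  Q≈ : ⟪ qpow 2 ⟫ ≈ Q
  Q≈ = trans (qpow≈pow 2) pow-2
  q+Q≈ : ⟪ qpow 1 +ₛ qpow 2 ⟫ ≈ q ⊕ Q
  q+Q≈ = trans {j = q ⊕ ⟪ qpow 2 ⟫} (mk λ _ → ≡.refl) (+-congˡ Q≈)
  pm∞-inverse : pm∞ ⊗ r∞ ≈ 𝟏
  pm∞-inverse = recip-inverse {pm∞} ≡.refl
  cube : recip (pm∞ ⊗ pm∞ ⊗ pm∞) ≈ r∞ ⊗ r∞ ⊗ r∞
  cube = inverse-unique (recip-inverse {pm∞ ⊗ pm∞ ⊗ pm∞} ≡.refl)
    (trans (solve 2 (λ p r → p :* p :* p :* (r :* r :* r) := p :* r :* (p :* r) :* (p :* r)) refl pm∞ r∞)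
      (trans (*-cong (*-cong pm∞-inverse pm∞-inverse) pm∞-inverse)
        (solve 0 (:1 :* :1 :* :1 := :1) refl)))

twiceG′≈twiceRHS : two ⊗ ⟪ G'gen ⟫ ≈ ⟪ twiceRHS ⟫
twiceG′≈twiceRHS = begin
  two ⊗ ⟪ G'gen ⟫
    ≈⟨ *-congˡ G′≈ ⟩
  two ⊗ (q ⊗ 1/pp∞ ⊗ ∑∞ t)
    ≈⟨ solve 3 (λ q i t → :2 :* (q :* i :* t) := q :* i :* (:2 :* t)) refl q 1/pp∞ (∑∞ t) ⟩
  q ⊗ 1/pp∞ ⊗ (two ⊗ ∑∞ t)
    ≈⟨ *-congˡ T-closed-form ⟩
  q ⊗ 1/pp∞ ⊗ (constant (+ 3) ⊕ ⊖ q ⊕ two ⊗ q ⊗ pp∞ ⊕ ⊖ (two ⊗ 1+q ⊗ pp∞ ⊗ φ) ⊕ 1+q ⊗ pp∞ ⊗ pp∞ ⊗ r∞ ⊗ r∞)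
    ≈⟨ solve 5 (λ q i c φ r → let z = :1 :+ q in
         q :* i :* (:3 :+ :- q :+ :2 :* q :* c :+ :- (:2 :* z :* c :* φ) :+ z :* c :* c :* r :* r)
         := (:3 :* q :+ :- (q :* q)) :* i
            :+ c :* i :* (:2 :* (q :* q) :+ :- (:2 :* (q :+ q :* q) :* φ) :+ (q :+ q :* q) :* c :* (r :* r)))
       refl q 1/pp∞ pp∞ φ r∞ ⟩
  (constant (+ 3) ⊗ q ⊕ ⊖ Q) ⊗ 1/pp∞
    ⊕ pp∞ ⊗ 1/pp∞ ⊗ (two ⊗ Q ⊕ ⊖ (two ⊗ (q ⊕ Q) ⊗ φ) ⊕ (q ⊕ Q) ⊗ pp∞ ⊗ (r∞ ⊗ r∞))
    -- The remaining (q;q)∞ is rewritten as (q²;q²)∞ / (-q;q)∞, which completes the cube of (-q;q)∞.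
    ≈⟨ +-congˡ (*-cong pp∞-inverse (+-congˡ (*-congʳ (*-congˡ (sym pQ∞r∞≈pp∞))))) ⟩
  (constant (+ 3) ⊗ q ⊕ ⊖ Q) ⊗ 1/pp∞
    ⊕ 𝟏 ⊗ (two ⊗ Q ⊕ ⊖ (two ⊗ (q ⊕ Q) ⊗ φ) ⊕ (q ⊕ Q) ⊗ (pQ∞ ⊗ r∞) ⊗ (r∞ ⊗ r∞))
    ≈⟨ solve 5 (λ q i φ p r →
         (:3 :* q :+ :- (q :* q)) :* i
           :+ :1 :* (:2 :* (q :* q) :+ :- (:2 :* (q :+ q :* q) :* φ) :+ (q :+ q :* q) :* (p :* r) :* (r :* r))
         := :2 :* (q :* q) :+ :- (:2 :* (q :+ q :* q) :* φ)
            :+ (:3 :* q :+ :- (q :* q)) :* i :+ (q :+ q :* q) :* p :* (r :* r :* r))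
       refl q 1/pp∞ φ pQ∞ r∞ ⟩
  two ⊗ Q ⊕ ⊖ (two ⊗ (q ⊕ Q) ⊗ φ) ⊕ (constant (+ 3) ⊗ q ⊕ ⊖ Q) ⊗ 1/pp∞ ⊕ (q ⊕ Q) ⊗ pQ∞ ⊗ (r∞ ⊗ r∞ ⊗ r∞)
    ≈⟨ twiceRHS≈ ⟨
  ⟪ twiceRHS ⟫ ∎

theorem6p1 : (n : ℕ) → (+ 2) * G' n ≡ twiceRHS n
theorem6p1 n = ≡.trans (≡.sym (const-* (+ 2) G'gen n)) (at twiceG′≈twiceRHS n)
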